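{- The following are equivalent for every idempotent algebra $\mathbf{A}$. (1) $\mathbf{A}$ is a Taylor algebra. (2) $\mathbf{A}$ has a double loop term. (3) $\mathbf{A}$ has a strong double loop term. (4) $\mathbf{A}$ has a weak 3-cube term. (5) There are $4$-ary terms $q_1,q_2$ and a ternary term $c$ in $\mathbf{A}$ satisfying \[ q_1(x,y,x,y)\approx q_1(y,x,x,y)\approx q_2(x,y,x,y)\approx q_2(y,x,x,y), \] \[ q_1(x,x,y,y)\approx c(x,y,x),\qquad q_2(x,x,y,y)\approx c(y,x,x). \] (6) $\mathbf{A}$ has terminator terms. (7) $\mathbf{A}$ has strong terminator terms.
   Context: Algebras have purely algebraic signatures (operation symbols of finite arities). An algebra is idempotent if each of its basic operations $f$ satisfies $f(a,a,\dots,a)=a$ for all elements $a$. An algebra satisfies an equation $s\approx t$ if both terms evaluate to the same element under every evaluation of the variables. Taylor algebras: An equational condition $\mathcal{S}$ is a system of equations in some signature $\Delta$. An algebra $\mathbf{A}$ of a signature $\Sigma$ satisfies $\mathcal{S}$ if one can replace each operation symbol in $\Delta$ by a term in the signature $\Sigma$ (of the same arity) so that all equations of $\mathcal{S}$ become satisfied in $\mathbf{A}$. An equational condition is trivial if it is satisfied in every algebra (equivalently, in an algebra in the empty signature with at least two elements), and nontrivial otherwise. It is idempotent if for each operation symbol $f$ appearing in it, the equation $f(x,\dots,x)\approx x$ is a consequence of its equations. An algebra is called Taylor if it satisfies a nontrivial idempotent equational condition. In each of the following, the displayed equations are required to be satisfied in $\mathbf{A}$. Double loop term: a $12$-ary term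 $d$ with \[ d(x,x,x,x,x,x,y,y,y,y,y,y)\approx d(x,x,y,y,y,y,x,x,x,x,y,y), \] \[ d(x,y,x,x,y,y,x,x,y,y,x,y)\approx d(y,x,x,y,x,y,x,y,x,y,y,x). \] Strong double loop term: a $12$-ary term $d$ for which all four expressions are equal: \[ d(x,x,x,x,x,x,y,y,y,y,y,y)\approx d(x,x,y,y,y,y,x,x,x,x,y,y)\approx d(x,y,x,x,y,y,x,x,y,y,x,y)\approx d(y,x,x,y,x,y,x,y,x,y,y,x). \] Weak 3-cube term: a $6$-ary term $t$ with \[ t(x,y,y,y,x,x)\approx t(y,x,y,x,y,x)\approx t(y,y,x,x,x,y). \] Terminator terms: ternary terms $c,c_1,c_2,c_{11},c_{12},c_{21},c_{22}$ with \[ c(x,y,x)\approx c_1(x,x,y),\qquad c(y,x,x)\approx c_2(x,x,y), \] and, for each $i\in\{1,2\}$, \[ c_i(x,y,x)\approx c_{i1}(x,x,y),\quad c_i(y,x,x)\approx c_{i2}(x,x,y),\quad c_{i1}(x,y,x)\approx c_{i2}(x,y,x),\quad c_{i1}(y,x,x)\approx c_{i2}(y,x,x). \] Strong terminator terms: terminator terms that moreover satisfy $c_{11}(y,x,x)\approx c_{22}(x,y,x)$. -}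

module Defs where

open import Data.Fin.Base using (Fin)
open import Data.Nat.Base using (ℕ)
open import Data.Product.Base using (Σ-syntax; _×_)
open import Data.Vec.Functional using (Vector; []; _∷_)
open import Level using (Level; suc)
open import Relation.Binary.Bundles using (Setoid)
open import Relation.Nullary.Negation.Core using (¬_)

-- One universe level ℓ plays the role of "sets" throughout: signatures,
-- systems of equations and algebras all live in Set ℓ.
private
  variable
    ℓ : Level

record Signature (ℓ : Level) : Set (suc ℓ) where
  field
    Op : Set ℓ
    ar : Op → ℕ

open Signature public

data Term {ℓ} (S : Signature ℓ) (X : Set) : Set ℓ where
  var : X → Term S X
  op  : (f : Op S) → (Fin (ar S f) → Term S X) → Term S X

-- A term of arity n is a term in the variables x₀, …, xₙ₋₁.
TermOf : Signature ℓ → ℕ → Set ℓ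
TermOf S n = Term S (Fin n)

infixl 8 _[_]

_[_] : {S : Signature ℓ} {X Y : Set} → Term S X → (X → Term S Y) → Term S Y
var x   [ θ ] = θ x
op f ts [ θ ] = op f (λ i → ts i [ θ ])

-- Algebras are carried by setoids, so that quotients of algebras (free
-- algebras in particular) are available; equality of elements is _≈_.
record Algebra {ℓ} (S : Signature ℓ) : Set (suc ℓ) where
  field
    domain : Setoid ℓ ℓ

  open Setoid domain public

  field
    interp      : (f : Op S) → Vector Carrier (ar S f) → Carrier
    interp-cong : (f : Op S) {u v : Vector Carrier (ar S f)} →
                  (∀ i → u i ≈ v i) → interp f u ≈ interp f v

  eval : {X : Set} → Term S X → (X → Carrier) → Carrier
  eval (var x)   ρ = ρ x
  eval (op f ts) ρ = interp f (λ i → eval (ts i) ρ)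

Idempotent : {S : Signature ℓ} → Algebra S → Set ℓ
Idempotent {S = S} A = (f : Op S) (a : Carrier) → interp f (λ _ → a) ≈ a
  where open Algebra A

infix 4 _⊨_≐_

_⊨_≐_ : {S : Signature ℓ} {X : Set} → Algebra S → Term S X → Term S X → Set ℓ
A ⊨ s ≐ t = ∀ ρ → eval s ρ ≈ eval t ρ
  where open Algebra A

-- A possibly infinite system of equations, over the countable supply of
-- variables var 0, var 1, ….
record EqCondition (ℓ : Level) : Set (suc ℓ) where
  field
    Δ       : Signature ℓ
    Eqn     : Set ℓ
    lhs rhs : Eqn → Term Δ ℕ

open EqCondition public

-- replace τ t is obtained from t by replacing each symbol f by the term τ f.
replace : {Δ S : Signature ℓ} {X : Set} →
          ((f : Op Δ) → TermOf S (ar Δ f)) → Term Δ X → Term S X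
replace τ (var x)   = var x
replace τ (op f ts) = τ f [ (λ i → replace τ (ts i)) ]

Satisfies : {S : Signature ℓ} → Algebra S → EqCondition ℓ → Set ℓ
Satisfies {S = S} A 𝓢 =
  Σ[ τ ∈ ((f : Op (Δ 𝓢)) → TermOf S (ar (Δ 𝓢) f)) ]
    (∀ e → A ⊨ replace τ (lhs 𝓢 e) ≐ replace τ (rhs 𝓢 e))

Trivial : EqCondition ℓ → Set (suc ℓ)
Trivial {ℓ} 𝓢 = (S : Signature ℓ) (A : Algebra S) → Satisfies A 𝓢

Consequence : (𝓢 : EqCondition ℓ) → Term (Δ 𝓢) ℕ → Term (Δ 𝓢) ℕ → Set (suc ℓ)
Consequence 𝓢 s t =
  (B : Algebra (Δ 𝓢)) → (∀ e → B ⊨ lhs 𝓢 e ≐ rhs 𝓢 e) → B ⊨ s ≐ t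

IdempotentCondition : EqCondition ℓ → Set (suc ℓ)
IdempotentCondition 𝓢 =
  (f : Op (Δ 𝓢)) → Consequence 𝓢 (op f (λ _ → var 0)) (var 0)

Taylor : {S : Signature ℓ} → Algebra S → Set (suc ℓ)
Taylor {ℓ} A =
  Σ[ 𝓢 ∈ EqCondition ℓ ] (¬ Trivial 𝓢 × IdempotentCondition 𝓢 × Satisfies A 𝓢)

module _ {S : Signature ℓ} (A : Algebra S) where
  open Algebra A

  HasDoubleLoopTerm : Set ℓ
  HasDoubleLoopTerm = Σ[ d ∈ TermOf S 12 ] (∀ x y →
      eval d (x ∷ x ∷ x ∷ x ∷ x ∷ x ∷ y ∷ y ∷ y ∷ y ∷ y ∷ y ∷ [])
    ≈ eval d (x ∷ x ∷ y ∷ y ∷ y ∷ y ∷ x ∷ x ∷ x ∷ x ∷ y ∷ y ∷ [])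
    × eval d (x ∷ y ∷ x ∷ x ∷ y ∷ y ∷ x ∷ x ∷ y ∷ y ∷ x ∷ y ∷ [])
    ≈ eval d (y ∷ x ∷ x ∷ y ∷ x ∷ y ∷ x ∷ y ∷ x ∷ y ∷ y ∷ x ∷ []))

  HasStrongDoubleLoopTerm : Set ℓ
  HasStrongDoubleLoopTerm = Σ[ d ∈ TermOf S 12 ] (∀ x y →
    let r₁ = eval d (x ∷ x ∷ x ∷ x ∷ x ∷ x ∷ y ∷ y ∷ y ∷ y ∷ y ∷ y ∷ [])
        r₂ = eval d (x ∷ x ∷ y ∷ y ∷ y ∷ y ∷ x ∷ x ∷ x ∷ x ∷ y ∷ y ∷ [])
        r₃ = eval d (x ∷ y ∷ x ∷ x ∷ y ∷ y ∷ x ∷ x ∷ y ∷ y ∷ x ∷ y ∷ [])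
        r₄ = eval d (y ∷ x ∷ x ∷ y ∷ x ∷ y ∷ x ∷ y ∷ x ∷ y ∷ y ∷ x ∷ [])
    in r₁ ≈ r₂ × r₂ ≈ r₃ × r₃ ≈ r₄)

  HasWeak3CubeTerm : Set ℓ
  HasWeak3CubeTerm = Σ[ t ∈ TermOf S 6 ] (∀ x y →
      eval t (x ∷ y ∷ y ∷ y ∷ x ∷ x ∷ []) ≈ eval t (y ∷ x ∷ y ∷ x ∷ y ∷ x ∷ [])
    × eval t (y ∷ x ∷ y ∷ x ∷ y ∷ x ∷ []) ≈ eval t (y ∷ y ∷ x ∷ x ∷ x ∷ y ∷ []))

  HasTermsQ₁Q₂C : Set ℓ
  HasTermsQ₁Q₂C =
    Σ[ q₁ ∈ TermOf S 4 ] Σ[ q₂ ∈ TermOf S 4 ] Σ[ c ∈ TermOf S 3 ] (∀ x y →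
      eval q₁ (x ∷ y ∷ x ∷ y ∷ []) ≈ eval q₁ (y ∷ x ∷ x ∷ y ∷ [])
    × eval q₁ (y ∷ x ∷ x ∷ y ∷ []) ≈ eval q₂ (x ∷ y ∷ x ∷ y ∷ [])
    × eval q₂ (x ∷ y ∷ x ∷ y ∷ []) ≈ eval q₂ (y ∷ x ∷ x ∷ y ∷ [])
    × eval q₁ (x ∷ x ∷ y ∷ y ∷ []) ≈ eval c (x ∷ y ∷ x ∷ [])
    × eval q₂ (x ∷ x ∷ y ∷ y ∷ []) ≈ eval c (y ∷ x ∷ x ∷ []))

  Branches : (p p₁ p₂ : TermOf S 3) → Set ℓ
  Branches p p₁ p₂ = ∀ x y →
      eval p (x ∷ y ∷ x ∷ []) ≈ eval p₁ (x ∷ x ∷ y ∷ [])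
    × eval p (y ∷ x ∷ x ∷ []) ≈ eval p₂ (x ∷ x ∷ y ∷ [])

  Agree : (p₁ p₂ : TermOf S 3) → Set ℓ
  Agree p₁ p₂ = ∀ x y →
      eval p₁ (x ∷ y ∷ x ∷ []) ≈ eval p₂ (x ∷ y ∷ x ∷ [])
    × eval p₁ (y ∷ x ∷ x ∷ []) ≈ eval p₂ (y ∷ x ∷ x ∷ [])

  record TerminatorTerms : Set ℓ where
    field
      c c₁ c₂ c₁₁ c₁₂ c₂₁ c₂₂ : TermOf S 3
      c-branches  : Branches c c₁ c₂
      c₁-branches : Branches c₁ c₁₁ c₁₂
      c₂-branches : Branches c₂ c₂₁ c₂₂
      c₁-agree    : Agree c₁₁ c₁₂
      c₂-agree    : Agree c₂₁ c₂₂

  StrongTerminatorTerms : Set ℓ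
  StrongTerminatorTerms = Σ[ T ∈ TerminatorTerms ] (∀ x y →
    let open TerminatorTerms T in
    eval c₁₁ (y ∷ x ∷ x ∷ []) ≈ eval c₂₂ (x ∷ y ∷ x ∷ []))

{-# OPTIONS --safe #-}
module Submission where

open import Defs
open import Axiom.ExcludedMiddle using (ExcludedMiddle)
open import Axiom.Extensionality.Propositional using (Extensionality)
open import Data.Bool.Base using (Bool; true; false; not; _xor_; _∧_; _∨_; if_then_else_)
import Data.Bool.Properties as Bool
open import Data.Empty using (⊥)
open import Data.Fin.Base using (Fin; zero; suc; _↑ˡ_; _↑ʳ_; splitAt; join)
open import Data.Fin using (#_)
open import Data.Fin.Properties
  using (_≟_; all?; ¬∀⟶∃¬; ∀-cons; join-splitAt; splitAt-↑ˡ; splitAt-↑ʳ; ↑ˡ-injective; ↑ʳ-injective)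
open import Data.Nat.Base using (ℕ; zero; suc; _+_; _<ᵇ_)
open import Data.Nat.Properties using (+-comm)
open import Data.Product.Base using (Σ-syntax; _×_; _,_; proj₁; proj₂)
open import Data.Sum.Base as Sum using (_⊎_; inj₁; inj₂)
open import Data.Unit.Base using (⊤; tt)
open import Data.Vec.Functional using (Vector; []; _∷_)
open import Function.Base using (_∘_)
open import Function.Bundles using (_⇔_; mk⇔)
open import Level using (Level)
open import Relation.Binary.PropositionalEquality as ≡
  using (_≡_; _≢_; refl; sym; trans; cong; subst)
open import Relation.Nullary using (Dec; yes; no; ¬_; contradiction; does)
open import Relation.Nullary.Decidable using (decidable-stable; from-yes; ¬?; _×-dec_; _→-dec_)

-- Let F be the algebra of binary terms, with letters x and y, and call a tuple of
-- pairs of elements of F a clause of literals p ≠ p′.  Let E be generated by the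
-- clauses over the letters in which some literal is true.  A maximal set of literals
-- from which no clause consisting of equalities is derivable would select one
-- coordinate of each operation, compatibly with all identities; so in a Taylor
-- algebra E contains, for some n, an n-tuple of equalities.
--
-- From n + 1 literals one gets down to n as long as n ≥ 2.  Keeping one literal as a
-- parameter, the last one gives a graph on F, in which the parameter absorbs all the
-- columns where any given literal is true.  The equality of n + 1 literals makes
-- cliques of the graph grow, and for a clique a₀ , … , aₙ the element
-- A = T (a₀ , … , aₙ) is adjacent to all aᵢ, hence to itself.
--
-- Two literals yield a weak 3-cube term by the idea of the local loop lemma.  If the
-- leaves of a tree of compositions are coloured by the letters so that no three
-- consecutive suffixes of a path have equal colours, then comparing the value A of
-- the tree with itself at delays 0, 1 and 2 shows that (A , A , A) is generated by the
-- nonconstant triples of letters.  Such a colouring only fails on long runs, where the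
-- equations of the two literals apply.

-- Zorn's lemma for Boolean-valued subsets

module Zorn (em : ∀ {a} → ExcludedMiddle a) (ext : ∀ {a b} → Extensionality a b)
            {x p : Level} {X : Set x} where

  Subset : Set x
  Subset = X → Bool

  infix 4 _∈_ _⊆_
  _∈_ : X → Subset → Set
  e ∈ N = N e ≡ true

  _⊆_ : Subset → Subset → Set x
  N ⊆ M = ∀ e → e ∈ N → e ∈ M

  ⊆-trans : ∀ {N M P} → N ⊆ M → M ⊆ P → N ⊆ P
  ⊆-trans f g e = g e ∘ f e

  ⊆-antisym : ∀ {N M} → N ⊆ M → M ⊆ N → N ≡ M
  ⊆-antisym {N} {M} f g = ext λ e → bool (N e) (M e) (f e) (g e)
    where
    bool : ∀ b c → (b ≡ true → c ≡ true) → (c ≡ true → b ≡ true) → b ≡ c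
    bool true  c f g = sym (f refl)
    bool false true  f g = g refl
    bool false false f g = refl

  ⟨_⟩ : ∀ {a} → (X → Set a) → Subset
  ⟨ P ⟩ e = does (em {P = P e})

  ⟨⟩-intro : ∀ {a} (P : X → Set a) {e} → P e → e ∈ ⟨ P ⟩
  ⟨⟩-intro P {e} h with em {P = P e}
  ... | yes _ = refl
  ... | no ¬h = contradiction h ¬h

  ⟨⟩-elim : ∀ {a} (P : X → Set a) {e} → e ∈ ⟨ P ⟩ → P e
  ⟨⟩-elim P {e} h with em {P = P e}
  ... | yes h′ = h′

  Member : (X → Subset) → X → Set x
  Member f e = Σ[ i ∈ X ] e ∈ f i

  ⋃ : (X → Subset) → Subset
  ⋃ f = ⟨ Member f ⟩

  ⋃-upper : ∀ f i → f i ⊆ ⋃ f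
  ⋃-upper f i e h = ⟨⟩-intro (Member f) (i , h)

  ⋃-least : ∀ f {N} → (∀ i → f i ⊆ N) → ⋃ f ⊆ N
  ⋃-least f h e e∈ with ⟨⟩-elim (Member f) e∈
  ... | i , e∈fi = h i e e∈fi

  Adjoined : Subset → X → X → Set x
  Adjoined N a e = e ∈ N ⊎ e ≡ a

  adjoin : Subset → X → Subset
  adjoin N a = ⟨ Adjoined N a ⟩

  Chain : (X → Subset) → Set x
  Chain f = ∀ i j → f i ⊆ f j ⊎ f j ⊆ f i

  module _ (Good : Subset → Set p) (start : Subset) (start-good : Good start) (x₀ : X)
           (⋃-good : ∀ f → Chain f → (∀ i → Good (f i)) → Good (⋃ f)) where

    Extension : Subset → Set _
    Extension N = Σ[ a ∈ X ] (N a ≡ false × Good (adjoin N a))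

    extend : Subset → Subset
    extend N with em {P = Extension N}
    ... | yes (a , _) = adjoin N a
    ... | no  _       = N

    ⊆-extend : ∀ N → N ⊆ extend N
    ⊆-extend N e e∈ with em {P = Extension N}
    ... | yes (a , _) = ⟨⟩-intro (Adjoined N a) (inj₁ e∈)
    ... | no  _       = e∈

    extend-good : ∀ N → Good N → Good (extend N)
    extend-good N g with em {P = Extension N}
    ... | yes (a , _ , g′) = g′
    ... | no  _            = g

    -- Ordinal notations, with limits indexed by X itself; the stages they denote
    -- form a chain by the Bourbaki–Witt argument.
    data Ordinal : Set x where
      zero : Ordinal
      suc  : Ordinal → Ordinal
      lim  : (X → Ordinal) → Ordinal

    stage : Ordinal → Subset
    stage zero    = start
    stage (suc α) = extend (stage α)
    stage (lim f) = ⋃ (λ i → stage (f i))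

    start⊆stage : ∀ α → start ⊆ stage α
    start⊆stage zero    e h = h
    start⊆stage (suc α) e h = ⊆-extend (stage α) e (start⊆stage α e h)
    start⊆stage (lim f) e h = ⋃-upper (λ i → stage (f i)) x₀ e (start⊆stage (f x₀) e h)

    No-gap : Ordinal → Set x
    No-gap α = ∀ β → stage β ⊆ stage α → stage α ⊆ stage β ⊎ stage (suc β) ⊆ stage α

    some-⊈-or-all-⊆ : ∀ (f : X → Subset) N → (Σ[ i ∈ X ] ¬ (f i ⊆ N)) ⊎ (∀ i → f i ⊆ N)
    some-⊈-or-all-⊆ f N with em {P = Σ[ i ∈ X ] ¬ (f i ⊆ N)}
    ... | yes h = inj₁ h
    ... | no ¬h = inj₂ λ i → decidable-stable em λ n → ¬h (i , n)

    -- `extend` picks its element without regard to inclusions and need not be monotone, so the two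
    -- stages are first identified by antisymmetry.
    suc-⊆ : ∀ α β → stage α ⊆ stage β → stage β ⊆ stage α → stage (suc α) ⊆ stage (suc β)
    suc-⊆ α β f g = subst (λ N → extend (stage α) ⊆ extend N) (⊆-antisym f g) (λ _ h → h)

    -- Induction on `β`: at a successor, `gap` prevents the step from `β` to `suc β` from jumping
    -- over `stage α`.
    below-or-above : ∀ α → No-gap α → ∀ β → stage β ⊆ stage α ⊎ stage (suc α) ⊆ stage β
    below-or-above α gap zero = inj₁ (start⊆stage α)
    below-or-above α gap (suc β) with below-or-above α gap β
    ... | inj₂ above = inj₂ (⊆-trans above (⊆-extend (stage β)))
    ... | inj₁ below with gap β below
    ...   | inj₁ above = inj₂ (suc-⊆ α β above below)
    ...   | inj₂ below′ = inj₁ below′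
    below-or-above α gap (lim f) with some-⊈-or-all-⊆ (λ i → stage (f i)) (stage α)
    ... | inj₂ all = inj₁ (⋃-least _ all)
    ... | inj₁ (i , ⊈) with below-or-above α gap (f i)
    ...   | inj₁ below = contradiction below ⊈
    ...   | inj₂ above = inj₂ (⊆-trans above (⋃-upper (λ j → stage (f j)) i))

    no-gap : ∀ α → No-gap α
    no-gap zero β below = inj₁ (start⊆stage β)
    no-gap (suc α) β below with below-or-above α (no-gap α) β
    ... | inj₂ above = inj₁ above
    ... | inj₁ below′ with no-gap α β below′
    ...   | inj₁ above  = inj₂ (suc-⊆ β α below′ above)
    ...   | inj₂ below″ = inj₂ (⊆-trans below″ (⊆-extend (stage α)))
    no-gap (lim f) β below with some-⊈-or-all-⊆ (λ i → stage (f i)) (stage β)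
    ... | inj₂ all = inj₁ (⋃-least _ all)
    ... | inj₁ (i , ⊈) with below-or-above (f i) (no-gap (f i)) β
    ...   | inj₂ above = contradiction (⊆-trans (⊆-extend (stage (f i))) above) ⊈
    ...   | inj₁ below′ with no-gap (f i) β below′
    ...     | inj₁ above  = contradiction above ⊈
    ...     | inj₂ below″ = inj₂ (⊆-trans below″ (⋃-upper (λ j → stage (f j)) i))

    comparable : ∀ α β → stage α ⊆ stage β ⊎ stage β ⊆ stage α
    comparable α β with below-or-above α (no-gap α) β
    ... | inj₁ below = inj₂ below
    ... | inj₂ above = inj₁ (⊆-trans (⊆-extend (stage α)) above)

    stage-good : ∀ α → Good (stage α)
    stage-good zero    = start-good
    stage-good (suc α) = extend-good (stage α) (stage-good α)
    stage-good (lim f) = ⋃-good _ (λ i j → comparable (f i) (f j)) (λ i → stage-good (f i))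

    index : X → Ordinal
    index e with em {P = Σ[ α ∈ Ordinal ] e ∈ stage α}
    ... | yes (α , _) = α
    ... | no  _       = zero

    -- An element of any stage lies in the stage indexed by that element. So a limit over `X` alone
    -- already bounds all stages, and extending it adds nothing.
    last : Ordinal
    last = lim index

    stage⊆last : ∀ α → stage α ⊆ stage last
    stage⊆last α e e∈ = ⋃-upper (λ i → stage (index i)) e e (e∈index e∈)
      where
      e∈index : e ∈ stage α → e ∈ stage (index e)
      e∈index h with em {P = Σ[ β ∈ Ordinal ] e ∈ stage β}
      ... | yes (β , e∈β) = e∈β
      ... | no ¬∃ = contradiction (α , h) ¬∃

    no-extension : ¬ Extension (stage last)
    no-extension ext′ with em {P = Extension (stage last)} | stage⊆last (suc last)
    ... | no ¬ext             | _   = ¬ext ext′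
    ... | yes (a , a∉ , good) | sub = contradiction (trans (sym (sub a (⟨⟩-intro (Adjoined (stage last) a) (inj₂ refl)))) a∉) λ ()

    maximal : Σ[ N ∈ Subset ] (start ⊆ N × Good N × (∀ a → N a ≡ false → ¬ Good (adjoin N a)))
    maximal = stage last , start⊆stage last , stage-good last ,
      λ a a∉ good → no-extension (a , a∉ , good)

-- Identities of an idempotent algebra and composition of binary terms

module Idem {ℓ : Level} {S : Signature ℓ} (A : Algebra S) (idem : Idempotent A) where
  open Algebra A using (Carrier; eval; interp; interp-cong; _≈_)
    renaming (refl to ≈-refl; sym to ≈-sym; trans to ≈-trans)

  -- A record rather than a function, so that Agda infers both sides.
  infix 4 _≐_
  record _≐_ {X : Set} (p q : Term S X) : Set ℓ where
    constructor pointwise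
    field at : A ⊨ p ≐ q

  open _≐_

  ≐-refl : {X : Set} {p : Term S X} → p ≐ p
  ≐-refl .at ρ = ≈-refl

  ≐-sym : {X : Set} {p q : Term S X} → p ≐ q → q ≐ p
  ≐-sym e .at ρ = ≈-sym (e .at ρ)

  ≐-trans : {X : Set} {p q r : Term S X} → p ≐ q → q ≐ r → p ≐ r
  ≐-trans e f .at ρ = ≈-trans (e .at ρ) (f .at ρ)

  ≡⇒≐ : {X : Set} {p q : Term S X} → p ≡ q → p ≐ q
  ≡⇒≐ refl = ≐-refl

  eval-cong : {X : Set} (t : Term S X) {ρ σ : X → Carrier} → (∀ v → ρ v ≈ σ v) → eval t ρ ≈ eval t σ
  eval-cong (var v)   e = e v
  eval-cong (op f ts) e = interp-cong f (λ i → eval-cong (ts i) e)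

  eval-[] : {X Y : Set} (t : Term S X) (θ : X → Term S Y) (ρ : Y → Carrier) →
            eval (t [ θ ]) ρ ≈ eval t (λ v → eval (θ v) ρ)
  eval-[] (var v)   θ ρ = ≈-refl
  eval-[] (op f ts) θ ρ = interp-cong f (λ i → eval-[] (ts i) θ ρ)

  eval-const : {X : Set} (t : Term S X) (a : Carrier) → eval t (λ _ → a) ≈ a
  eval-const (var v)   a = ≈-refl
  eval-const (op f ts) a = ≈-trans (interp-cong f (λ i → eval-const (ts i) a)) (idem f a)

  []-cong : {X Y : Set} (t : Term S X) {θ η : X → Term S Y} → (∀ v → θ v ≐ η v) → t [ θ ] ≐ t [ η ]
  []-cong t {θ} {η} e .at ρ =
    ≈-trans (eval-[] t θ ρ) (≈-trans (eval-cong t (λ v → e v .at ρ)) (≈-sym (eval-[] t η ρ)))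

  ≐-[] : {X Y : Set} {p q : Term S X} (θ : X → Term S Y) → p ≐ q → p [ θ ] ≐ q [ θ ]
  ≐-[] {p = p} {q} θ e .at ρ = ≈-trans (eval-[] p θ ρ) (≈-trans (e .at _) (≈-sym (eval-[] q θ ρ)))

  []-assoc : {X Y Z : Set} (t : Term S X) (θ : X → Term S Y) (η : Y → Term S Z) →
             t [ θ ] [ η ] ≐ t [ (λ v → θ v [ η ]) ]
  []-assoc t θ η .at ρ = ≈-trans (eval-[] (t [ θ ]) η ρ) (≈-trans (eval-[] t θ _)
    (≈-sym (≈-trans (eval-[] t _ ρ) (eval-cong t (λ v → eval-[] (θ v) η ρ)))))

  []-const : {X Y : Set} (t : Term S X) (p : Term S Y) → t [ (λ _ → p) ] ≐ p
  []-const t p .at ρ = ≈-trans (eval-[] t _ ρ) (eval-const t _)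

  []-const′ : {X Y : Set} (t : Term S X) {θ : X → Term S Y} {p : Term S Y} →
              (∀ v → θ v ≐ p) → t [ θ ] ≐ p
  []-const′ t {p = p} e = ≐-trans ([]-cong t e) ([]-const t p)

  []-var : {X : Set} (t : Term S X) {θ : X → Term S X} → (∀ v → θ v ≡ var v) → t [ θ ] ≐ t
  []-var t {θ} e .at ρ = ≈-trans (eval-[] t θ ρ) (eval-cong t (λ v → ≡⇒≐ (e v) .at ρ))

  -- The free algebra on the two letters var true and var false is the algebra
  -- of binary terms modulo _≐_.
  F : Set ℓ
  F = Term S Bool

  bar : F → F
  bar p = p [ (λ b → var (not b)) ]

  ± : F → Bool → F
  ± g true  = g
  ± g false = bar g

  infixr 9 _⊙_
  -- Composition of binary terms, with `g` put for x and its mirror image `bar g` for y. Modulo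
  -- `_≐_` it is a monoid with unit `var true`.
  _⊙_ : F → F → F
  p ⊙ g = p [ ± g ]

  bar-bar : ∀ p → bar (bar p) ≐ p
  bar-bar p = ≐-trans ([]-assoc p _ _) ([]-var p (λ { true → refl ; false → refl }))

  bar-± : ∀ g b → bar (± g b) ≐ ± g (not b)
  bar-± g true  = ≐-refl
  bar-± g false = bar-bar g

  bar-cong : ∀ {p q} → p ≐ q → bar p ≐ bar q
  bar-cong = ≐-[] _

  ±-cong : ∀ {p q} b → p ≐ q → ± p b ≐ ± q b
  ±-cong true  e = e
  ±-cong false e = bar-cong e

  bar-⊙ : ∀ p g → bar (p ⊙ g) ≐ bar p ⊙ g
  bar-⊙ p g = ≐-trans ([]-assoc p _ _)
    (≐-trans ([]-cong p (bar-± g)) (≐-sym ([]-assoc p _ _)))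

  ⊙-± : ∀ p g b → ± p b ⊙ g ≐ ± (p ⊙ g) b
  ⊙-± p g true  = ≐-refl
  ⊙-± p g false = ≐-sym (bar-⊙ p g)

  ⊙-cong : ∀ p {g h} → g ≐ h → p ⊙ g ≐ p ⊙ h
  ⊙-cong p e = []-cong p (λ b → ±-cong b e)

  ⊙-assoc : ∀ p q r → (p ⊙ q) ⊙ r ≐ p ⊙ (q ⊙ r)
  ⊙-assoc p q r = ≐-trans ([]-assoc p _ _) ([]-cong p (⊙-± q r))

  ⊙-identityʳ : ∀ p → p ⊙ var true ≐ p
  ⊙-identityʳ p = []-var p (λ { true → refl ; false → refl })

  -- Clauses and the relation generated by the true ones

  Tuple : Set → Set ℓ
  Tuple J = J → F × F

  infix 4 _≐²_
  record _≐²_ (p q : F × F) : Set ℓ where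
    constructor _,_
    field
      left  : proj₁ p ≐ proj₁ q
      right : proj₂ p ≐ proj₂ q

  open _≐²_

  infixl 8 _[_]²
  _[_]² : {X : Set} → Term S X → (X → F × F) → F × F
  t [ θ ]² = t [ proj₁ ∘ θ ] , t [ proj₂ ∘ θ ]

  -- A column of n literals; literal j of it is true when its two entries differ.
  record Column (n : ℕ) : Set where
    constructor column
    field
      entry   : Fin n → Bool × Bool
      witness : Fin n
      differ  : proj₂ (entry witness) ≡ not (proj₁ (entry witness))

  open Column public

  letters : Bool × Bool → F × F
  letters (b , b′) = var b , var b′

  -- The subalgebra of (F²)ⁿ generated by the columns.
  E : (n : ℕ) → Tuple (Fin n) → Set ℓ
  E n a = Σ[ T ∈ Term S (Column n) ] (∀ i → T [ (λ γ → letters (entry γ i)) ]² ≐² a i)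

  E-resp : ∀ {n} {a b : Tuple (Fin n)} → (∀ i → a i ≐² b i) → E n a → E n b
  E-resp e (T , h) = T , λ i → ≐-trans (left (h i)) (left (e i)) , ≐-trans (right (h i)) (right (e i))

  E-closed : ∀ {n} {X : Set} (t : Term S X) {as : X → Tuple (Fin n)} →
             (∀ v → E n (as v)) → E n (λ i → t [ (λ v → as v i) ]²)
  E-closed t h = t [ (λ v → proj₁ (h v)) ] , λ i →
      ≐-trans ([]-assoc t _ _) ([]-cong t (λ v → left (proj₂ (h v) i)))
    , ≐-trans ([]-assoc t _ _) ([]-cong t (λ v → right (proj₂ (h v) i)))

  -- The composite of `a zero` with copies of `T` gives `a zero` in the first coordinate, where each
  -- copy collapses to a letter, and `T` in the others, where all copies coincide.
  Π-generated : ∀ n (a : Fin n → F) → Σ[ T ∈ Term S (Fin n → Bool) ] (∀ i → T [ (λ β → var (β i)) ] ≐ a i)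
  Π-generated zero    a = var (λ ()) , λ ()
  Π-generated (suc n) a with Π-generated n (a ∘ suc)
  ... | T , h = a zero [ (λ b → T [ (λ β → var (b ∷ β)) ]) ] , λ
    { zero    → ≐-trans ([]-assoc (a zero) _ _) (≐-trans
                  ([]-cong (a zero) (λ b → ≐-trans ([]-assoc T _ _) ([]-const T (var b))))
                  ([]-var (a zero) (λ _ → refl)))
    ; (suc i) → ≐-trans ([]-assoc (a zero) _ _)
                  ([]-const′ (a zero) (λ b → ≐-trans ([]-assoc T _ _) (h i))) }

  Π²-generated : ∀ n (a : Tuple (Fin n)) →
                 Σ[ T ∈ Term S (Fin n → Bool × Bool) ] (∀ i → T [ (λ γ → letters (γ i)) ]² ≐² a i)
  Π²-generated n a with Π-generated n (proj₁ ∘ a) | Π-generated n (proj₂ ∘ a)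
  ... | T , h | U , k = T [ (λ β → U [ (λ δ → var (λ i → β i , δ i)) ]) ] , λ i →
      ≐-trans ([]-assoc T _ _) (≐-trans ([]-cong T (λ β → ≐-trans ([]-assoc U _ _) ([]-const U _))) (h i))
    , ≐-trans ([]-assoc T _ _) ([]-const′ T (λ β → ≐-trans ([]-assoc U _ _) (k i)))

  replaceAt : ∀ {n} {B : Set} → Fin n → B → (Fin n → B) → Fin n → B
  replaceAt j b γ i with i ≟ j
  ... | yes _ = b
  ... | no  _ = γ i

  replaceAt-eq : ∀ {n} {B : Set} (j : Fin n) (b : B) γ → replaceAt j b γ j ≡ b
  replaceAt-eq j b γ with j ≟ j
  ... | yes _ = refl
  ... | no ¬p = contradiction refl ¬p

  -- Overwriting literal `j` by (b , not b) turns arbitrary tuples of letters into columns.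
  -- Composing with `g` over b then produces (g , bar g) at `j`, while idempotence preserves the
  -- other literals.
  E-true : ∀ {n} {a : Tuple (Fin n)} j g → a j ≐² (g , bar g) → E n a
  E-true {n} {a} j g e with Π²-generated n a
  ... | T , h = g [ (λ b → T [ (λ γ → var (col b γ)) ]) ] , λ i → go i
    where
    col : Bool → (Fin n → Bool × Bool) → Column n
    col b γ = column (replaceAt j (b , not b) γ) j
      (subst (λ p → proj₂ p ≡ not (proj₁ p)) (sym (replaceAt-eq j (b , not b) γ)) refl)
    go : ∀ i → (g [ (λ b → T [ (λ γ → var (col b γ)) ]) ]) [ (λ γ → letters (entry γ i)) ]² ≐² a i
    go i = ≐-trans ([]-assoc g _ _) (≐-trans ([]-cong g (λ b → []-assoc T _ _)) (proj₁ (go′ i)))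
         , ≐-trans ([]-assoc g _ _) (≐-trans ([]-cong g (λ b → []-assoc T _ _)) (proj₂ (go′ i)))
      where
      go′ : ∀ i → (g [ (λ b → T [ (λ γ → proj₁ (letters (replaceAt j (b , not b) γ i))) ]) ] ≐ proj₁ (a i))
                × (g [ (λ b → T [ (λ γ → proj₂ (letters (replaceAt j (b , not b) γ i))) ]) ] ≐ proj₂ (a i))
      go′ i with i ≟ j
      ... | yes refl = ≐-trans ([]-cong g (λ b → []-const T (var b))) (≐-trans ([]-var g (λ _ → refl)) (≐-sym (left e)))
                     , ≐-trans ([]-cong g (λ b → []-const T (var (not b)))) (≐-sym (right e))
      ... | no _     = ≐-trans ([]-const g _) (left (h i)) , ≐-trans ([]-const g _) (right (h i))

  E-true′ : ∀ {n} {a : Tuple (Fin n)} j g b → a j ≐² (± g b , ± g (not b)) → E n a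
  E-true′ j g true  e = E-true j g e
  E-true′ j g false e = E-true j (bar g) (left e , ≐-trans (right e) (≐-sym (bar-bar g)))

  -- The substitution sends a generating column to a clause that is still complementary at its
  -- witness, so `E-true′` applies.
  E-⊙ : ∀ {n} {a : Tuple (Fin n)} (g : Fin n → F) → E n a → E n (λ i → proj₁ (a i) ⊙ g i , proj₂ (a i) ⊙ g i)
  E-⊙ {n} {a} g (T , h) = E-resp
    (λ i → ≐-trans (≐-sym ([]-assoc T _ _)) (≐-[] _ (left (h i)))
         , ≐-trans (≐-sym ([]-assoc T _ _)) (≐-[] _ (right (h i))))
    (E-closed T {as = λ γ i → ± (g i) (proj₁ (entry γ i)) , ± (g i) (proj₂ (entry γ i))}
      (λ γ → E-true′ (witness γ) (g (witness γ)) (proj₁ (entry γ (witness γ)))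
        (≐-refl , ≡⇒≐ (cong (± (g (witness γ))) (differ γ)))))

  E-± : ∀ {n} {a : Tuple (Fin n)} (β : Fin n → Bool) → E n a → E n (λ i → ± (proj₁ (a i)) (β i) , ± (proj₂ (a i)) (β i))
  E-± β h = E-resp (λ i → ±-var (β i) _ , ±-var (β i) _) (E-⊙ (λ i → ± (var true) (β i)) h)
    where
    ±-var : ∀ b p → p ⊙ ± (var true) b ≐ ± p b
    ±-var true  p = ⊙-identityʳ p
    ±-var false p = []-cong p (λ { true → ≐-refl ; false → ≐-refl })

  loop : ∀ {n} → (Fin n → F) → Tuple (Fin n)
  loop a i = a i , a i

  E-loop-⊙ : ∀ {n} {a : Fin n → F} (p : Fin n → F) → E n (loop a) → E n (loop (λ i → p i ⊙ a i))
  E-loop-⊙ {n} {a} p h with Π-generated n p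
  ... | T , k = E-resp (λ i → e i , e i) (E-closed T (λ β → E-± β h))
    where
    e : ∀ i → T [ (λ β → ± (a i) (β i)) ] ≐ p i ⊙ a i
    e i = ≐-trans (≐-sym ([]-assoc T _ _)) (≐-[] _ (k i))

  Loop : ℕ → Set ℓ
  Loop n = Σ[ c ∈ F ] E n (loop (λ _ → c))

  -- The element `c` is the composite of all aᵢ in order; the factors on the left and right are what
  -- precedes and follows aᵢ. This gives the entries of a loop a common value.
  common-composite : ∀ n (a : Fin n → F) →
    Σ[ c ∈ F ] Σ[ l ∈ (Fin n → F) ] Σ[ r ∈ (Fin n → F) ] (∀ i → l i ⊙ (a i ⊙ r i) ≐ c)
  common-composite zero    a = var true , (λ ()) , (λ ()) , λ ()
  common-composite (suc n) a with common-composite n (a ∘ suc)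
  ... | c , l , r , h = a zero ⊙ c , (var true ∷ λ i → a zero ⊙ l i) , (c ∷ r) , λ
    { zero    → ≐-refl
    ; (suc i) → ≐-trans (⊙-assoc (a zero) (l i) _) (⊙-cong (a zero) (h i)) }

  E-loop⇒Loop : ∀ {n} (a : Fin n → F) → E n (loop a) → Loop n
  E-loop⇒Loop {n} a h with common-composite n a
  ... | c , l , r , e = c , E-resp (λ i → e i , e i) (E-loop-⊙ l (E-⊙ r h))

  -- The new literals are (true , true) in every column, hence become equalities of `var true`.
  Loop-weaken : ∀ m {n} → Loop n → Loop (n + m)
  Loop-weaken m {n} (c , T , h) = E-loop⇒Loop a (T [ (λ γ → var (ext γ)) ] , go)
    where
    f : (Fin n → Bool × Bool) → Fin n ⊎ Fin m → Bool × Bool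
    f γ (inj₁ i) = γ i
    f γ (inj₂ _) = true , true
    ext : Column n → Column (n + m)
    ext γ = column (λ i → f (entry γ) (splitAt n i)) (witness γ ↑ˡ m)
      (subst (λ s → proj₂ (f (entry γ) s) ≡ not (proj₁ (f (entry γ) s))) (sym (splitAt-↑ˡ n (witness γ) m)) (differ γ))
    val : Fin n ⊎ Fin m → F
    val (inj₁ _) = c
    val (inj₂ _) = var true
    a : Fin (n + m) → F
    a i = val (splitAt n i)
    go : ∀ i → T [ (λ γ → var (ext γ)) ] [ (λ γ → letters (entry γ i)) ]² ≐² (a i , a i)
    go i = ≐-trans ([]-assoc T _ _) (left (go′ (splitAt n i))) , ≐-trans ([]-assoc T _ _) (right (go′ (splitAt n i)))
      where
      go′ : ∀ s → T [ (λ γ → letters (f (entry γ) s)) ]² ≐² (val s , val s)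
      go′ (inj₁ j) = h j
      go′ (inj₂ j) = []-const T _ , []-const T _

  -- Reducing the number of literals

  -- All literals but the first, the passive ones, are equalities.
  N : ℕ → F → F → F → Set ℓ
  N k w q q′ = E (2 + k) ((q , q′) ∷ loop (λ _ → w))

  module _ {k : ℕ} where
    N-resp : ∀ {w p p′ q q′} → p ≐ q → p′ ≐ q′ → N k w p p′ → N k w q q′
    N-resp e e′ = E-resp λ { zero → e , e′ ; (suc i) → ≐-refl , ≐-refl }

    N-closed : ∀ {w} {X : Set} (t : Term S X) {q q′ : X → F} →
               (∀ v → N k w (q v) (q′ v)) → N k w (t [ q ]) (t [ q′ ])
    N-closed t h = E-resp
      (λ { zero → ≐-refl , ≐-refl ; (suc i) → []-const t _ , []-const t _ }) (E-closed t h)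

    N-sign : ∀ {w q q′} (β : Fin (suc k) → Bool) → N k w q q′ →
             E (2 + k) ((q , q′) ∷ loop (λ i → ± w (β i)))
    N-sign β h = E-resp
      (λ { zero → ≐-refl , ≐-refl ; (suc i) → ≐-refl , ≐-refl }) (E-± (true ∷ β) h)

    -- `c` is applied to copies of the edge with passive entries w and bar w; the endpoints survive
    -- by idempotence. This brings edges to the parameter that `N-absorb` produces.
    N-⊙ : ∀ {w q q′} c → N k w q q′ → N k (c ⊙ w) q q′
    N-⊙ c h = E-resp
      (λ { zero → []-const c _ , []-const c _ ; (suc i) → ≐-refl , ≐-refl })
      (E-closed c (λ b → N-sign (λ _ → b) h))

  Equal : ∀ {n} → Column n → Fin n → Set
  Equal γ i = proj₁ (entry γ i) ≡ proj₂ (entry γ i)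

  not-Equal : ∀ {n} (γ : Column n) → ¬ Equal γ (witness γ)
  not-Equal γ e = Bool.not-¬ refl (trans e (differ γ))

  -- Passive literals may be taken from the loop T itself: where they differ, the
  -- pair (q γ , q′ γ) is arbitrary.
  N-absorb : ∀ {k m} {c w : F} (T : Term S (Column m)) →
    (∀ i → T [ (λ γ → letters (entry γ i)) ]² ≐² (c , c)) →
    (s : Fin (suc k) → Fin m) {q q′ : Column m → F} →
    (∀ γ → (∀ i → Equal γ (s i)) → N k w (q γ) (q′ γ)) →
    N k (c ⊙ w) (T [ q ]) (T [ q′ ])
  N-absorb {k} {m} {c} {w} T h s {q} {q′} N-equal = E-resp
    (λ { zero → ≐-refl , ≐-refl
       ; (suc i) → ≐-trans (≐-sym ([]-assoc T _ _)) (≐-[] _ (left (h (s i))))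
                 , ≐-trans (≐-sym ([]-assoc T _ _)) (≐-[] _ (right (h (s i)))) })
    (E-closed T columnwise)
    where
    tuple : Column m → Tuple (Fin (2 + k))
    tuple γ = (q γ , q′ γ) ∷ λ i → ± w (proj₁ (entry γ (s i))) , ± w (proj₂ (entry γ (s i)))
    columnwise : ∀ γ → E (2 + k) (tuple γ)
    columnwise γ with all? (λ i → proj₁ (entry γ (s i)) Bool.≟ proj₂ (entry γ (s i)))
    ... | yes e = E-resp
      (λ { zero → ≐-refl , ≐-refl ; (suc i) → ≐-refl , ≡⇒≐ (cong (± w) (e i)) })
      (N-sign (λ i → proj₁ (entry γ (s i))) (N-equal γ e))
    ... | no ¬e with ¬∀⟶∃¬ _ _ (λ i → proj₁ (entry γ (s i)) Bool.≟ proj₂ (entry γ (s i))) ¬e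
    ...   | i , ≢ = E-true′ (suc i) w (proj₁ (entry γ (s i)))
      (≐-refl , ≡⇒≐ (cong (± w) (Bool.¬-not (≢ ∘ sym))))

  Clique : ℕ → F → (r : ℕ) → (Fin r → F) → Set ℓ
  Clique k w r b = ∀ i j → i ≢ j → N k w (b i) (b j)

  -- The first two vertices of a clique serve as colours for a triangle, each edge
  -- of which is guarded by an active literal: removing an edge makes the triangle
  -- 2-colourable.
  module _ {k : ℕ} (L : Loop (3 + k)) where
    private
      c = proj₁ L
      T = proj₁ (proj₂ L)
      T-loop = proj₂ (proj₂ L)

    active : Fin 3 → Fin (3 + k)
    active l = l ↑ˡ k

    passive : Fin k → Fin (3 + k)
    passive i = 3 ↑ʳ i

    -- Active literals 0, 1, 2 guard the edges 01, 12, 02. The one monochromatic edge is 01 if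
    -- literal 0 is true, else 12 if literal 1 is true, else 02.
    colour : Bool → Bool → Fin 3 → Fin 2
    colour true  _     = zero     ∷ zero     ∷ suc zero ∷ []
    colour false true  = suc zero ∷ zero     ∷ zero     ∷ []
    colour false false = zero     ∷ suc zero ∷ zero     ∷ []

    literal-differs : Column (3 + k) → Fin 3 → Bool
    literal-differs γ l = proj₁ (entry γ (active l)) xor proj₂ (entry γ (active l))

    γ-colour : Column (3 + k) → Fin 3 → Fin 2
    γ-colour γ = colour (literal-differs γ zero) (literal-differs γ (suc zero))

    Equal⇒false : ∀ γ l → Equal γ (active l) → literal-differs γ l ≡ false
    Equal⇒false γ l e = trans (cong (_xor proj₂ (entry γ (active l))) e) (Bool.xor-same (proj₂ (entry γ (active l))))

    false⇒Equal : ∀ γ l → literal-differs γ l ≡ false → Equal γ (active l)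
    false⇒Equal γ l e with proj₁ (entry γ (active l)) | proj₂ (entry γ (active l))
    ... | true  | true  = refl
    ... | false | false = refl

    not-all-Equal : ∀ γ → (∀ l → Equal γ (active l)) → ¬ (∀ i → Equal γ (passive i))
    not-all-Equal γ e e′ with witness γ | not-Equal γ
    ... | zero              | ≢ = ≢ (e zero)
    ... | suc zero          | ≢ = ≢ (e (suc zero))
    ... | suc (suc zero)    | ≢ = ≢ (e (suc (suc zero)))
    ... | suc (suc (suc i)) | ≢ = ≢ (e′ i)

    edge : (i j : Fin 3) → i ≢ j → Fin 3
    edge i j i≢j = guard i j
      where
      guard : Fin 3 → Fin 3 → Fin 3
      guard zero             (suc zero)       = zero
      guard (suc zero)       zero             = zero
      guard (suc zero)       (suc (suc zero)) = suc zero
      guard (suc (suc zero)) (suc zero)       = suc zero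
      guard _                _                = suc (suc zero)

    edge-colour : ∀ γ i j (i≢j : i ≢ j) → Equal γ (active (edge i j i≢j)) →
                  (∀ i → Equal γ (passive i)) → γ-colour γ i ≢ γ-colour γ j
    edge-colour γ i j i≢j e p = go i j i≢j
        (literal-differs γ zero) refl (literal-differs γ (suc zero)) refl e
      where
      go : ∀ i j (i≢j : i ≢ j) d₀ → literal-differs γ zero ≡ d₀ → ∀ d₁ → literal-differs γ (suc zero) ≡ d₁ →
           Equal γ (active (edge i j i≢j)) → colour d₀ d₁ i ≢ colour d₀ d₁ j
      go zero zero n = contradiction refl n
      go (suc zero) (suc zero) n = contradiction refl n
      go (suc (suc zero)) (suc (suc zero)) n = contradiction refl n
      go zero (suc zero) _ true eq d₁ _ e = contradiction (trans (sym eq) (Equal⇒false γ _ e)) λ ()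
      go zero (suc zero) _ false _ true  _ _ = λ ()
      go zero (suc zero) _ false _ false _ _ = λ ()
      go (suc zero) zero _ true eq d₁ _ e = contradiction (trans (sym eq) (Equal⇒false γ _ e)) λ ()
      go (suc zero) zero _ false _ true  _ _ = λ ()
      go (suc zero) zero _ false _ false _ _ = λ ()
      go (suc zero) (suc (suc zero)) _ true  _ _     _ _ = λ ()
      go (suc zero) (suc (suc zero)) _ false _ true  eq e = contradiction (trans (sym eq) (Equal⇒false γ _ e)) λ ()
      go (suc zero) (suc (suc zero)) _ false _ false _ _ = λ ()
      go (suc (suc zero)) (suc zero) _ true  _ _     _ _ = λ ()
      go (suc (suc zero)) (suc zero) _ false _ true  eq e = contradiction (trans (sym eq) (Equal⇒false γ _ e)) λ ()
      go (suc (suc zero)) (suc zero) _ false _ false _ _ = λ ()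
      go zero (suc (suc zero)) _ true  _ _    _ _ = λ ()
      go zero (suc (suc zero)) _ false _ true _ _ = λ ()
      -- Here edge 02 is monochromatic, but with its guard and the passive literals also equalities
      -- the column would have no witness.
      go zero (suc (suc zero)) _ false eq₀ false eq₁ e = contradiction p (not-all-Equal γ
        λ { zero → false⇒Equal γ _ eq₀ ; (suc zero) → false⇒Equal γ _ eq₁ ; (suc (suc zero)) → e })
      go (suc (suc zero)) zero _ true  _ _    _ _ = λ ()
      go (suc (suc zero)) zero _ false _ true _ _ = λ ()
      go (suc (suc zero)) zero _ false eq₀ false eq₁ e = contradiction p (not-all-Equal γ
        λ { zero → false⇒Equal γ _ eq₀ ; (suc zero) → false⇒Equal γ _ eq₁ ; (suc (suc zero)) → e })

    module _ {w : F} {r : ℕ} (b : Fin (2 + r) → F) (b-clique : Clique k w (2 + r) b) where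
      triangle : Fin 3 → F
      triangle i = T [ (λ γ → b (γ-colour γ i ↑ˡ r)) ]

      larger : Fin 3 ⊎ Fin r → F
      larger (inj₁ i) = triangle i
      larger (inj₂ l) = b (2 ↑ʳ l)

      ↑ˡ-≢ : ∀ {i j : Fin 2} → i ≢ j → i ↑ˡ r ≢ j ↑ˡ r
      ↑ˡ-≢ n e = n (↑ˡ-injective r _ _ e)

      ↑ˡ-≢-↑ʳ : ∀ (i : Fin 2) (l : Fin r) → i ↑ˡ r ≢ 2 ↑ʳ l
      ↑ˡ-≢-↑ʳ zero       l ()
      ↑ˡ-≢-↑ʳ (suc zero) l ()

      -- Two vertices give way to a triangle. An edge of the triangle is absorbed together with its
      -- guard; edges to the old vertices follow from idempotence of `T`.
      larger-clique : ∀ u v → u ≢ v → N k (c ⊙ w) (larger u) (larger v)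
      larger-clique (inj₁ i) (inj₁ j) n = N-absorb T T-loop
        (active (edge i j i≢j) ∷ passive)
        (λ γ e → b-clique _ _ (↑ˡ-≢ (edge-colour γ i j i≢j (e zero) (e ∘ suc))))
        where i≢j = n ∘ cong inj₁
      larger-clique (inj₁ i) (inj₂ l) _ = N-⊙ c (N-resp ≐-refl ([]-const T _)
        (N-closed T (λ γ → b-clique _ _ (↑ˡ-≢-↑ʳ (γ-colour γ i) l))))
      larger-clique (inj₂ l) (inj₁ i) _ = N-⊙ c (N-resp ([]-const T _) ≐-refl
        (N-closed T (λ γ → b-clique _ _ (↑ˡ-≢-↑ʳ (γ-colour γ i) l ∘ sym))))
      larger-clique (inj₂ l) (inj₂ l′) n = N-⊙ c (b-clique _ _ (λ e → n (cong inj₂ (↑ʳ-injective 2 _ _ e))))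

    cliques : ∀ r → Σ[ w ∈ F ] Σ[ b ∈ (Fin (2 + r) → F) ] Clique k w (2 + r) b
    cliques zero = var true , (var true ∷ var false ∷ []) , λ
      { zero       zero       n → contradiction refl n
      ; zero       (suc zero) _ → E-true zero (var true) (≐-refl , ≐-refl)
      ; (suc zero) zero       _ → E-true zero (var false) (≐-refl , ≐-refl)
      ; (suc zero) (suc zero) n → contradiction refl n }
    cliques (suc r) with cliques r
    ... | w , b , b-clique = c ⊙ w , larger b b-clique ∘ splitAt 3 , λ i j i≢j →
      larger-clique b b-clique (splitAt 3 i) (splitAt 3 j) (i≢j ∘ splitAt-injective i j)
      where
      splitAt-injective : ∀ (i j : Fin (3 + r)) → splitAt 3 i ≡ splitAt 3 j → i ≡ j
      splitAt-injective i j e =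
        trans (sym (join-splitAt 3 r i)) (trans (cong (join 3 r) e) (join-splitAt 3 r j))

    -- For a clique a and A = T(a) the absorption gives a N A, and then A N A.
    Loop-reduce : Loop (2 + k)
    -- This clique has 3 + k vertices, one for each literal of `T`.
    Loop-reduce with cliques (suc k)
    ... | w , a , a-clique = E-loop⇒Loop (A₀ ∷ λ _ → c ⊙ w)
        (E-resp (λ { zero → ≐-refl , []-const T A₀ ; (suc i) → ≐-refl , ≐-refl })
          (N-closed T (λ γ → edge-to-A (witness γ))))
      where
      A₀ : F
      A₀ = T [ a ∘ witness ]
      edge-to-A : ∀ l → N k (c ⊙ w) (a l) A₀
      -- All passive literals are copies of literal `l`. A column where it is an equality has
      -- another witness, whose vertex is adjacent to `a l`.
      edge-to-A l = N-resp ([]-const T _) ≐-refl (N-absorb T T-loop (λ _ → l)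
        (λ γ e → a-clique _ _ (λ l≡ → not-Equal γ (subst (Equal γ) l≡ (e zero)))))

  Loop-2 : ∀ k → Loop (2 + k) → Loop 2
  Loop-2 zero    L = L
  Loop-2 (suc k) L = Loop-2 k (Loop-reduce L)

  -- From two literals to a weak 3-cube term

  record NotAllEqual : Set where
    constructor nae
    field
      bit     : Fin 3 → Bool
      first   : Fin 3
      second  : Fin 3
      differs : bit second ≡ not (bit first)

  open NotAllEqual

  R : (Fin 3 → F) → Set ℓ
  R a = Σ[ U ∈ Term S NotAllEqual ] (∀ i → U [ (λ ν → var (bit ν i)) ] ≐ a i)

  R-resp : ∀ {a b} → (∀ i → a i ≐ b i) → R a → R b
  R-resp e (U , h) = U , λ i → ≐-trans (h i) (e i)

  R-closed : {X : Set} (t : Term S X) {as : X → Fin 3 → F} → (∀ v → R (as v)) → R (λ i → t [ (λ v → as v i) ])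
  R-closed t h = t [ proj₁ ∘ h ] , λ i → ≐-trans ([]-assoc t _ _) ([]-cong t (λ v → proj₂ (h v) i))

  R-complement : ∀ {a} i j g → i ≢ j → a i ≐ g → a j ≐ bar g → R a
  R-complement {a} i j g i≢j ei ej with Π-generated 3 a
  ... | U , h = g [ (λ b → U [ (λ β → var (triple b β)) ]) ] , λ k →
      ≐-trans ([]-assoc g _ _) (≐-trans ([]-cong g (λ b → []-assoc U _ _)) (value k))
    where
    bits : Bool → (Fin 3 → Bool) → Fin 3 → Bool
    bits b β = replaceAt j (not b) (replaceAt i b β)
    bits-i : ∀ b β → bits b β i ≡ b
    bits-i b β with i ≟ j
    ... | yes e = contradiction e i≢j
    ... | no _  = replaceAt-eq i b β
    triple : Bool → (Fin 3 → Bool) → NotAllEqual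
    triple b β = nae (bits b β) i j (trans (replaceAt-eq j (not b) _) (cong not (sym (bits-i b β))))
    value : ∀ k → g [ (λ b → U [ (λ β → var (bits b β k)) ]) ] ≐ a k
    value k with k ≟ j
    ... | yes refl = ≐-trans ([]-cong g (λ b → []-const U _)) (≐-sym ej)
    ... | no _ with k ≟ i
    ...   | yes refl = ≐-trans ([]-cong g (λ b → []-const U _)) (≐-trans ([]-var g (λ _ → refl)) (≐-sym ei))
    ...   | no _     = ≐-trans ([]-const g _) (h k)

  -- The first false literal of a column, with the common value of its entries;
  -- columns in which both literals are true are put in agree₂ true.
  data Class : Set where
    agree₁ agree₂ : Bool → Class

  class-of : Bool × Bool → Bool × Bool → Class
  class-of (true  , true)  _               = agree₁ true
  class-of (false , false) _               = agree₁ false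
  class-of _               (false , false) = agree₂ false
  class-of _               _               = agree₂ true

  class : Column 2 → Class
  class γ = class-of (entry γ zero) (entry γ (suc zero))

  -- A coloured tree of compositions

  data Tree : Set where
    letter  : Bool → Tree
    special : Bool → Tree
    node    : (Class → Tree) → Tree

  -- A leaf is its own child because `T` of a constant is that constant.
  child : Tree → Class → Tree
  child (node f) κ = f κ
  child t        κ = t

  complementary : Tree → Tree → Bool
  complementary (letter b)  (letter b′)  = b xor b′
  complementary (special b) (special b′) = b xor b′
  complementary _           _            = false

  is-letter : Bool → Tree → Bool
  is-letter b (letter b′) = not (b xor b′)
  is-letter b _           = false

  -- `special true` stands for `c`, the value of `T` on the first and also on the second entries of
  -- a literal. Columnwise the triple is (b , b′ , f κ): it is nonconstant if the literal is true,
  -- and otherwise if `f` returns the letter opposite to b.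
  absorbed : Tree → Tree → Tree → Bool
  absorbed (special true) (special true) (node f) =
      (is-letter false (f (agree₁ true)) ∧ is-letter true (f (agree₁ false)))
    ∨ (is-letter false (f (agree₂ true)) ∧ is-letter true (f (agree₂ false)))
  absorbed _ _ _ = false

  for-all-classes : (Class → Bool) → Bool
  for-all-classes p = (p (agree₁ true) ∧ p (agree₁ false)) ∧ (p (agree₂ true) ∧ p (agree₂ false))

  check : ℕ → Tree → Tree → Tree → Bool
  check zero    _ _ _ = false
  check (suc n) t u v =
      (complementary t u ∨ complementary u v)
    ∨ (complementary t v ∨ absorbed t u v)
    ∨ for-all-classes (λ κ → check n (child t κ) (child u κ) (child v κ))

  side : Class → Bool
  side (agree₁ _) = false
  side (agree₂ _) = true

  value : Class → Bool
  value (agree₁ b) = b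
  value (agree₂ b) = b

  odd : ℕ → Bool
  odd zero    = false
  odd (suc n) = not (odd n)

  -- The path in the tree is read as a word over the two sides.  A letter is a colour
  -- given to the suffixes of the word so that no three consecutive suffixes have
  -- the same one.  The colours alternate along a run of one side σ, ending in σ;
  -- r is the number of letters of the run that remain and κ is the class which ends
  -- it.  Where r ≥ 6 the colour is shifted, if needed, so that r = 7 gives the colour
  -- opposite to value κ, as absorption requires.
  colour-of-suffix : Bool → ℕ → Class → Bool
  colour-of-suffix σ r κ = (σ xor not (odd r)) xor ((5 <ᵇ r) ∧ not (σ xor value κ))

  -- The last two suffixes before a run of length 8 are special too.
  before-long-run : Tree → Tree → Bool → ℕ → Tree
  before-long-run s l σ zero    = s
  before-long-run s l σ (suc k) = node λ κ → if side κ xor σ then l else before-long-run s l σ k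

  end-of-run : Bool → ℕ → Class → Tree
  end-of-run σ 1 κ = before-long-run (special false) (letter (colour-of-suffix σ 1 κ)) (not σ) 7
  end-of-run σ 2 κ = before-long-run (special true) (letter (colour-of-suffix σ 2 κ)) (not σ) 7
  end-of-run σ r κ = letter (colour-of-suffix σ r κ)

  run : Bool → ℕ → ℕ → Tree
  run σ r zero    = special true
  run σ r (suc k) = node λ κ → if side κ xor σ then end-of-run σ r κ else run σ (suc r) k

  root : Tree
  root = node λ κ → run (side κ) 1 7

  check-from : Class → Class → Bool
  check-from κ κ′ = check 12 (child (child root κ) κ′) (child root κ′) root

  -- By evaluation over the sixteen pairs of initial classes; the bound `12` exceeds the depth of
  -- `root`.
  check-root : for-all-classes (λ κ → for-all-classes (check-from κ)) ≡ true
  check-root = refl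

  ∧-true : ∀ x {y} → x ∧ y ≡ true → (x ≡ true) × (y ≡ true)
  ∧-true true {true} _ = refl , refl

  ∨-true : ∀ {x y} → x ∨ y ≡ true → (x ≡ true) ⊎ (y ≡ true)
  ∨-true {true}  _ = inj₁ refl
  ∨-true {false} e = inj₂ e

  xor-true : ∀ x {y} → x xor y ≡ true → y ≡ not x
  xor-true true  {false} _ = refl
  xor-true false {true}  _ = refl

  is-letter-true : ∀ b {t} → is-letter b t ≡ true → t ≡ letter b
  is-letter-true true  {letter true}  _ = refl
  is-letter-true false {letter false} _ = refl

  all-classes : ∀ p → for-all-classes p ≡ true → ∀ κ → p κ ≡ true
  all-classes p e κ with ∧-true (p (agree₁ true) ∧ p (agree₁ false)) e
  ... | e₁ , e₂ with ∧-true (p (agree₁ true)) e₁ | ∧-true (p (agree₂ true)) e₂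
  all-classes p e (agree₁ true)  | _ | e₁ , _ | _ = e₁
  all-classes p e (agree₁ false) | _ | _ , e₂ | _ = e₂
  all-classes p e (agree₂ true)  | _ | _ | e₁ , _ = e₁
  all-classes p e (agree₂ false) | _ | _ | _ , e₂ = e₂

  module _ (L : Loop 2) where
    private
      c = proj₁ L
      T = proj₁ (proj₂ L)
      T-loop = proj₂ (proj₂ L)

    ⟦_⟧ : Tree → F
    ⟦ letter b ⟧  = var b
    ⟦ special b ⟧ = ± c b
    ⟦ node f ⟧    = T [ (λ γ → ⟦ f (class γ) ⟧) ]

    ⟦_∣_∣_⟧ : Tree → Tree → Tree → Fin 3 → F
    ⟦ t ∣ u ∣ v ⟧ = ⟦ t ⟧ ∷ ⟦ u ⟧ ∷ ⟦ v ⟧ ∷ []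

    expand : ∀ t → T [ (λ γ → ⟦ child t (class γ) ⟧) ] ≐ ⟦ t ⟧
    expand (letter b)  = []-const T _
    expand (special b) = []-const T _
    expand (node f)    = ≐-refl

    R-expand : ∀ t u v → (∀ κ → R ⟦ child t κ ∣ child u κ ∣ child v κ ⟧) → R ⟦ t ∣ u ∣ v ⟧
    R-expand t u v h = R-resp
      (λ { zero → expand t ; (suc zero) → expand u ; (suc (suc zero)) → expand v })
      (R-closed T (λ γ → h (class γ)))

    R-expand₁ : ∀ t u v → (∀ κ → R ⟦ child t κ ∣ u ∣ v ⟧) → R ⟦ t ∣ u ∣ v ⟧
    R-expand₁ t u v h = R-resp
      (λ { zero → expand t ; (suc zero) → []-const T _ ; (suc (suc zero)) → []-const T _ })
      (R-closed T (λ γ → h (class γ)))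

    R-expand₂ : ∀ t u v → (∀ κ → R ⟦ child t κ ∣ child u κ ∣ v ⟧) → R ⟦ t ∣ u ∣ v ⟧
    R-expand₂ t u v h = R-resp
      (λ { zero → expand t ; (suc zero) → expand u ; (suc (suc zero)) → []-const T _ })
      (R-closed T (λ γ → h (class γ)))

    complementary-sound : ∀ t u → complementary t u ≡ true → Σ[ g ∈ F ] (⟦ t ⟧ ≐ g × ⟦ u ⟧ ≐ bar g)
    complementary-sound (letter b) (letter b′) e =
      var b , ≐-refl , ≡⇒≐ (cong var (xor-true b e))
    complementary-sound (special b) (special b′) e =
      ± c b , ≐-refl , ≐-trans (≡⇒≐ (cong (± c) (xor-true b e))) (≐-sym (bar-± c b))


    R-absorbed : ∀ (l : Fin 2) (f : Class → Tree) →
      (∀ γ b → entry γ l ≡ (b , b) → f (class γ) ≡ letter (not b)) →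
      R ⟦ special true ∣ special true ∣ node f ⟧
    R-absorbed l f opposite = R-resp
      (λ { zero → left (T-loop l) ; (suc zero) → right (T-loop l) ; (suc (suc zero)) → ≐-refl })
      (R-closed T columnwise)
      where
      columnwise : ∀ γ → R (proj₁ (letters (entry γ l)) ∷ proj₂ (letters (entry γ l)) ∷ ⟦ f (class γ) ⟧ ∷ [])
      columnwise γ with entry γ l in e
      ... | b , b′ with b Bool.≟ b′
      ...   | yes refl = R-complement zero (suc (suc zero)) (var b) (λ ()) ≐-refl
                (≡⇒≐ (cong ⟦_⟧ (opposite γ b e)))
      ...   | no b≢b′ = R-complement zero (suc zero) (var b) (λ ()) ≐-refl
                (≡⇒≐ (cong var (Bool.¬-not (b≢b′ ∘ sym))))

    class₁ : ∀ γ b → entry γ zero ≡ (b , b) → class γ ≡ agree₁ b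
    class₁ γ true  e = cong (λ p → class-of p (entry γ (suc zero))) e
    class₁ γ false e = cong (λ p → class-of p (entry γ (suc zero))) e

    -- The second literal being false, the witness is the first one; its entries differ, so
    -- `class-of` looks at the second.
    class₂ : ∀ γ b → entry γ (suc zero) ≡ (b , b) → class γ ≡ agree₂ b
    class₂ (column e zero d) b e₁ with e zero | e (suc zero)
    class₂ (column e zero d) true  refl | true  , false | _ = refl
    class₂ (column e zero d) true  refl | false , true  | _ = refl
    class₂ (column e zero d) false refl | true  , false | _ = refl
    class₂ (column e zero d) false refl | false , true  | _ = refl
    class₂ (column e (suc zero) d) b e₁ with e (suc zero)
    class₂ (column e (suc zero) d) b refl | _ = contradiction d (Bool.not-¬ refl)

    absorbed-sound : ∀ t u v → absorbed t u v ≡ true → R ⟦ t ∣ u ∣ v ⟧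
    absorbed-sound (special true) (special true) (node f) e with ∨-true e
    ... | inj₁ e₁ = R-absorbed zero f λ γ b e → trans (cong f (class₁ γ b e)) (opposite b)
      where
      opposite : ∀ b → f (agree₁ b) ≡ letter (not b)
      opposite true  = is-letter-true false (proj₁ (∧-true _ e₁))
      opposite false = is-letter-true true (proj₂ (∧-true (is-letter false (f (agree₁ true))) e₁))
    ... | inj₂ e₂ = R-absorbed (suc zero) f λ γ b e → trans (cong f (class₂ γ b e)) (opposite b)
      where
      opposite : ∀ b → f (agree₂ b) ≡ letter (not b)
      opposite true  = is-letter-true false (proj₁ (∧-true _ e₂))
      opposite false = is-letter-true true (proj₂ (∧-true (is-letter false (f (agree₂ true))) e₂))

    check-sound : ∀ n t u v → check n t u v ≡ true → R ⟦ t ∣ u ∣ v ⟧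
    check-sound (suc n) t u v e with ∨-true e
    ... | inj₁ e′ with ∨-true e′
    ...   | inj₁ e″ = let g , p , q = complementary-sound t u e″ in
            R-complement zero (suc zero) g (λ ()) p q
    ...   | inj₂ e″ = let g , p , q = complementary-sound u v e″ in
            R-complement (suc zero) (suc (suc zero)) g (λ ()) p q
    check-sound (suc n) t u v e | inj₂ e′ with ∨-true e′
    ...   | inj₂ e″ = R-expand t u v λ κ → check-sound n (child t κ) (child u κ) (child v κ)
            (all-classes (λ κ → check n (child t κ) (child u κ) (child v κ)) e″ κ)
    ...   | inj₁ e″ with ∨-true e″
    ...     | inj₁ e‴ = let g , p , q = complementary-sound t v e‴ in
              R-complement zero (suc (suc zero)) g (λ ()) p q
    ...     | inj₂ e‴ = absorbed-sound t u v e‴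

    -- Reading the tree with delays 0, 1 and 2 compares consecutive suffixes.
    R-root : R ⟦ root ∣ root ∣ root ⟧
    R-root = R-expand₁ root root root λ κ → R-expand₂ (child root κ) root root λ κ′ →
      check-sound 12 (child (child root κ) κ′) (child root κ′) root
        (all-classes (check-from κ) (all-classes (λ κ → for-all-classes (check-from κ)) check-root κ) κ′)

  -- Consistent sets of literals

  _≐²-trans_ : ∀ {p q r} → p ≐² q → q ≐² r → p ≐² r
  (e , e′) ≐²-trans (f , f′) = ≐-trans e f , ≐-trans e′ f′

  ≐²-refl : ∀ {p} → p ≐² p
  ≐²-refl = ≐-refl , ≐-refl

  ≐²-sym : ∀ {p q} → p ≐² q → q ≐² p
  ≐²-sym (e , e′) = ≐-sym e , ≐-sym e′

  op² : (f : Op S) → (Fin (ar S f) → F × F) → F × F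
  op² f ps = op f (proj₁ ∘ ps) , op f (proj₂ ∘ ps)

  op²-const : ∀ f {ps} p → (∀ i → ps i ≐² p) → op² f ps ≐² p
  op²-const f p e = []-const′ (op f var) (left ∘ e) , []-const′ (op f var) (right ∘ e)

  -- Finiteness by a listing that may repeat. Clauses can thus be indexed by sums and are numbered
  -- only when a `Loop` is extracted.
  Listed : Set → Set
  Listed J = Σ[ n ∈ ℕ ] Σ[ π ∈ (Fin n → J) ] (∀ j → Σ[ i ∈ Fin n ] π i ≡ j)

  Listed-Fin : ∀ n → Listed (Fin n)
  Listed-Fin n = n , (λ i → i) , λ i → i , refl

  Listed-⊎ : ∀ {J K} → Listed J → Listed K → Listed (J ⊎ K)
  Listed-⊎ {J} {K} (m , π , π-onto) (n , ρ , ρ-onto) = m + n , (λ i → Sum.map π ρ (splitAt m i)) , onto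
    where
    onto : ∀ s → Σ[ i ∈ Fin (m + n) ] Sum.map π ρ (splitAt m i) ≡ s
    onto (inj₁ j) with π-onto j
    ... | i , refl = i ↑ˡ n , cong (Sum.map π ρ) (splitAt-↑ˡ m i n)
    onto (inj₂ k) with ρ-onto k
    ... | i , refl = m ↑ʳ i , cong (Sum.map π ρ) (splitAt-↑ʳ m n i)

  module Classical (em : ∀ {a} → ExcludedMiddle a) (ext : ∀ {a b} → Extensionality a b) where
    open Zorn em ext {p = Level.suc Level.zero Level.⊔ ℓ} {X = F × F}

    -- Clauses (finite disjunctions of literals p ≠ p′) obtained from those with a
    -- literal in Γ by applying operations.
    data Derivable (Γ : Subset) {J : Set} : Tuple J → Set ℓ where
      literal : ∀ {a} j p → p ∈ Γ → a j ≐² p → Derivable Γ a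
      apply   : ∀ {a} f (as : Fin (ar S f) → Tuple J) → (∀ i → Derivable Γ (as i)) →
                (∀ j → op² f (λ i → as i j) ≐² a j) → Derivable Γ a

    Equalities : {J : Set} → Tuple J → Set ℓ
    Equalities a = ∀ j → proj₁ (a j) ≐ proj₂ (a j)

    Inconsistent : Subset → Set _
    Inconsistent Γ = Σ[ J ∈ Set ] Listed J × Σ[ a ∈ Tuple J ] (Equalities a × Derivable Γ a)

    Consistent : Subset → Set _
    Consistent Γ = ¬ Inconsistent Γ

    Derivable-⊆ : ∀ {Γ Δ} → Γ ⊆ Δ → {J : Set} {a : Tuple J} → Derivable Γ a → Derivable Δ a
    Derivable-⊆ sub (literal j p p∈ e)  = literal j p (sub p p∈) e
    Derivable-⊆ sub (apply f as h e) = apply f as (λ i → Derivable-⊆ sub (h i)) e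

    reindex : ∀ {Γ} {J K : Set} (π : K → J) (σ : J → K) → (∀ j → π (σ j) ≡ j) →
              {a : Tuple J} → Derivable Γ a → Derivable Γ (a ∘ π)
    reindex π σ e {a} (literal j p p∈ e′) =
      literal (σ j) p p∈ (subst (λ i → a i ≐² p) (sym (e j)) e′)
    reindex π σ e (apply f as h e′) = apply f (λ i → as i ∘ π) (λ i → reindex π σ e (h i)) (e′ ∘ π)

    infixr 5 _⊕_
    _⊕_ : {J K : Set} → Tuple J → Tuple K → Tuple (J ⊎ K)
    _⊕_ = Sum.[_,_]′

    override : {K : Set} → K → F × F → Tuple K → Tuple K
    override k p l k′ with em {P = k′ ≡ k}
    ... | yes _ = p
    ... | no  _ = l k′

    override-at : {K : Set} (k : K) (p : F × F) (l : Tuple K) → override k p l k ≡ p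
    override-at k p l with em {P = k ≡ k}
    ... | yes _ = refl
    ... | no ¬e = contradiction refl ¬e

    -- The derivation is replayed with `l` in place of its first literal: each operand contributes
    -- its own literal at `k`, and the rest of `l` is preserved by idempotence.
    move-literal : ∀ {Γ} {J K : Set} (k : K) (l : Tuple K) {a : Tuple (⊤ ⊎ J)} → a (inj₁ tt) ≐² l k →
                   Derivable Γ a → Derivable Γ (l ⊕ a ∘ inj₂)
    move-literal k l e (literal (inj₁ tt) p p∈ e′) = literal (inj₁ k) p p∈ (≐²-sym e ≐²-trans e′)
    move-literal k l e (literal (inj₂ j) p p∈ e′)  = literal (inj₂ j) p p∈ e′
    move-literal {Γ} {J} {K} k l {a} e (apply f as h e′) = apply f (λ i → ls i ⊕ as i ∘ inj₂)
      (λ i → move-literal k (ls i) (subst (as i (inj₁ tt) ≐²_) (sym (override-at k _ l)) ≐²-refl) (h i))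
      λ { (inj₁ k′) → at-K k′ ; (inj₂ j) → e′ (inj₂ j) }
      where
      ls : Fin (ar S f) → Tuple K
      ls i = override k (as i (inj₁ tt)) l
      at-K : ∀ k′ → op² f (λ i → ls i k′) ≐² l k′
      at-K k′ with em {P = k′ ≡ k}
      ... | yes refl = e′ (inj₁ tt) ≐²-trans e
      ... | no _     = op²-const f (l k′) (λ i → ≐²-refl)

    -- Resolution: every use of `p` in the derivation of `l` is replaced by the derivation of `a`,
    -- whose remaining literals are carried along.
    cut : ∀ {Γ p} {J K : Set} {l : Tuple K} {a : Tuple (⊤ ⊎ J)} → a (inj₁ tt) ≐² p →
          Derivable (adjoin Γ p) l → Derivable Γ a → Derivable Γ (l ⊕ a ∘ inj₂)
    cut {Γ} {p} {l = l} e (literal k q q∈ e′) h with ⟨⟩-elim (Adjoined Γ p) q∈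
    ... | inj₁ q∈Γ = literal (inj₁ k) q q∈Γ e′
    ... | inj₂ refl = move-literal k l (e ≐²-trans ≐²-sym e′) h
    cut {a = a} e (apply f ls hs e′) h = apply f (λ i → ls i ⊕ a ∘ inj₂) (λ i → cut e (hs i) h)
      λ { (inj₁ k) → e′ k ; (inj₂ j) → op²-const f (a (inj₂ j)) (λ i → ≐²-refl) }

    -- Each cut trades a refutable literal for the equalities of its refutation, until only
    -- equalities remain.
    cut-all : ∀ {Γ} n (P : Fin n → F × F) → (∀ i → Inconsistent (adjoin Γ (P i))) →
              {J : Set} → Listed J → (a : Tuple J) → Equalities a → Derivable Γ (P ⊕ a) → Inconsistent Γ
    cut-all zero P inc J-listed a eqs h =
      _ , Listed-⊎ (Listed-Fin 0) J-listed , P ⊕ a , (λ { (inj₂ j) → eqs j }) , h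
    cut-all {Γ} (suc n) P inc {J} J-listed a eqs h with inc zero
    ... | K , K-listed , l , l-eqs , hl =
      cut-all n (P ∘ suc) (inc ∘ suc) (Listed-⊎ K-listed J-listed) (l ⊕ a)
        (λ { (inj₁ k) → l-eqs k ; (inj₂ j) → eqs j })
        (resp (reindex to from from-to (cut {p = P zero} ≐²-refl hl (reindex split glue glue-split h))))
      where
      split : ⊤ ⊎ (Fin n ⊎ J) → Fin (suc n) ⊎ J
      split (inj₁ tt)       = inj₁ zero
      split (inj₂ (inj₁ i)) = inj₁ (suc i)
      split (inj₂ (inj₂ j)) = inj₂ j
      glue : Fin (suc n) ⊎ J → ⊤ ⊎ (Fin n ⊎ J)
      glue (inj₁ zero)    = inj₁ tt
      glue (inj₁ (suc i)) = inj₂ (inj₁ i)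
      glue (inj₂ j)       = inj₂ (inj₂ j)
      glue-split : ∀ s → split (glue s) ≡ s
      glue-split (inj₁ zero)    = refl
      glue-split (inj₁ (suc i)) = refl
      glue-split (inj₂ j)       = refl
      to : Fin n ⊎ (K ⊎ J) → K ⊎ (Fin n ⊎ J)
      to (inj₁ i)        = inj₂ (inj₁ i)
      to (inj₂ (inj₁ k)) = inj₁ k
      to (inj₂ (inj₂ j)) = inj₂ (inj₂ j)
      from : K ⊎ (Fin n ⊎ J) → Fin n ⊎ (K ⊎ J)
      from (inj₁ k)        = inj₂ (inj₁ k)
      from (inj₂ (inj₁ i)) = inj₁ i
      from (inj₂ (inj₂ j)) = inj₂ (inj₂ j)
      from-to : ∀ s → to (from s) ≡ s
      from-to (inj₁ k)        = refl
      from-to (inj₂ (inj₁ i)) = refl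
      from-to (inj₂ (inj₂ j)) = refl
      resp : Derivable Γ ((l ⊕ ((P ⊕ a) ∘ split) ∘ inj₂) ∘ to) → Derivable Γ (P ∘ suc ⊕ (l ⊕ a))
      resp = Derivable-resp λ { (inj₁ i) → ≐²-refl ; (inj₂ (inj₁ k)) → ≐²-refl ; (inj₂ (inj₂ j)) → ≐²-refl }
        where
        Derivable-resp : {L : Set} {b c : Tuple L} → (∀ s → b s ≐² c s) → Derivable Γ b → Derivable Γ c
        Derivable-resp e (literal j p p∈ e′) = literal j p p∈ (≐²-sym (e j) ≐²-trans e′)
        Derivable-resp e (apply f as h e′)   = apply f as h (λ j → e′ j ≐²-trans e j)

    -- A derivation uses finitely many members of the chain, and the largest of them contains all
    -- its literals.
    ⋃-consistent : ∀ Γ → Chain Γ → (∀ i → Consistent (Γ i)) → Consistent (⋃ Γ)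
    ⋃-consistent Γ chain con (J , J-listed , a , eqs , h) with in-one h
      where
      bound : ∀ n (g : Fin n → F × F) → Σ[ i ∈ F × F ] (∀ k → Γ (g k) ⊆ Γ i)
      bound zero    g = (var true , var true) , λ ()
      bound (suc n) g with bound n (g ∘ suc)
      ... | i , b with chain (g zero) i
      ...   | inj₁ sub = i , λ { zero → sub ; (suc k) → b k }
      ...   | inj₂ sub = g zero , λ { zero _ e → e ; (suc k) → ⊆-trans (b k) sub }
      in-one : {J : Set} {a : Tuple J} → Derivable (⋃ Γ) a → Σ[ i ∈ F × F ] Derivable (Γ i) a
      in-one (literal j p p∈ e) with ⟨⟩-elim (Member Γ) p∈
      ... | i , p∈Γi = i , literal j p p∈Γi e
      in-one (apply f as h e) with bound _ (λ i → proj₁ (in-one (h i)))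
      ... | i , b = i , apply f as (λ k → Derivable-⊆ (b k) (proj₂ (in-one (h k)))) e
    ... | i , h′ = con i (J , J-listed , a , eqs , h′)

    Letters : F × F → Set ℓ
    Letters p = p ≡ (var true , var false)

    Inconsistent⇒Loop : Inconsistent ⟨ Letters ⟩ → Σ[ n ∈ ℕ ] Loop n
    Inconsistent⇒Loop (J , (n , π , onto) , a , eqs , h) = n , E-loop⇒Loop (proj₁ ∘ a ∘ π)
      (E-resp (λ i → ≐-refl , ≐-sym (eqs (π i))) (derivable-E h))
      where
      derivable-E : {b : Tuple J} → Derivable ⟨ Letters ⟩ b → E n (b ∘ π)
      derivable-E (literal j p p∈ e) with onto j | ⟨⟩-elim Letters p∈
      ... | i , refl | refl = E-true i (var true) e
      derivable-E (apply f as h e) =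
        E-resp (λ i → e (π i)) (E-closed (op f var) (λ k → derivable-E (h k)))

    -- Projections from a maximal consistent set

    module Maximal (Γ : Subset) (letters⊆Γ : ⟨ Letters ⟩ ⊆ Γ) (con : Consistent Γ)
                   (max : ∀ p → Γ p ≡ false → ¬ Consistent (adjoin Γ p)) where
      In : F × F → Set ℓ
      In p = Σ[ q ∈ F × F ] (q ∈ Γ × p ≐² q)

      Selects : (f : Op S) → Fin (ar S f) → Set ℓ
      Selects f i = ∀ ps → In (ps i) → In (op² f ps)

      -- Otherwise the literals witnessing the failure of each coordinate form a
      -- derivable clause; each of them is refutable, so cutting them all refutes Γ.
      selects : ∀ f → Σ[ i ∈ Fin (ar S f) ] Selects f i
      selects f = decidable-stable em λ none → con
        (refute λ i → decidable-stable em λ ¬bad → none (i , λ ps in-ps →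
          decidable-stable em λ ¬in → ¬bad (ps , in-ps , ¬in)))
        where
        refute : (∀ i → Σ[ ps ∈ (Fin (ar S f) → F × F) ] (In (ps i) × ¬ In (op² f ps))) → Inconsistent Γ
        refute bad = cut-all {Γ} (ar S f) (λ i → op² f (proj₁ (bad i)))
          (λ i → decidable-stable em (max _ (Bool.¬-not λ e → proj₂ (proj₂ (bad i)) (_ , e , ≐²-refl))))
          (Listed-Fin 0) (λ ()) (λ ())
          (apply f (λ c → (λ i → proj₁ (bad i) c) ⊕ (λ ()))
            (λ c → literal-of c (proj₁ (proj₂ (bad c))))
            λ { (inj₁ i) → ≐²-refl })
          where
          literal-of : ∀ c → In (proj₁ (bad c) c) → Derivable Γ ((λ i → proj₁ (bad i) c) ⊕ (λ ()))
          literal-of c (q , q∈ , e) = literal (inj₁ c) q q∈ e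

      coordinate : {X : Set} → Term S X → X
      coordinate (var v)   = v
      coordinate (op f ts) = coordinate (ts (proj₁ (selects f)))

      In-coordinate : {X : Set} (t : Term S X) {θ : X → F × F} → In (θ (coordinate t)) → In (t [ θ ]²)
      In-coordinate (var v)   h = h
      In-coordinate (op f ts) h = proj₂ (selects f) _ (In-coordinate (ts _) h)

      -- The composite s * t, evaluated at θ along s and at θ along t, gives s [ θ ] and
      -- t [ θ ] by idempotence; its selected coordinate is the pair of those of s and t.
      coordinate-cong : {X : Set} (s t : Term S X) → s ≐ t → coordinate s ≡ coordinate t
      coordinate-cong {X} s t s≐t = decidable-stable em λ p≢q → con
          (⊤ , (1 , (λ _ → tt) , λ _ → zero , refl) , (λ _ → pair)
          , (λ _ → ≐-trans ([]-cong s (λ _ → []-const t _)) (≐-trans (≐-[] θ s≐t) (≐-sym ([]-const s _))))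
          , derivation (In-coordinate s (In-coordinate t (in-letters p≢q))))
        where
        θ : X → F
        θ v = var (does (em {P = v ≡ coordinate s}))
        pair : F × F
        pair = s [ (λ v → t [ (λ u → θ v , θ u) ]²) ]²
        derivation : In pair → Derivable Γ {⊤} (λ _ → pair)
        derivation (q , q∈ , e) = literal tt q q∈ e
        in-letters : coordinate s ≢ coordinate t → In (θ (coordinate s) , θ (coordinate t))
        in-letters p≢q with em {P = coordinate s ≡ coordinate s} | em {P = coordinate t ≡ coordinate s}
        ... | no ¬e | _     = contradiction refl ¬e
        ... | yes _ | yes e = contradiction (sym e) p≢q
        ... | yes _ | no _  = _ , letters⊆Γ _ (⟨⟩-intro Letters refl) , ≐²-refl

      coordinate-[] : {X Y : Set} (t : Term S X) (θ : X → Term S Y) →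
                      coordinate (t [ θ ]) ≡ coordinate (θ (coordinate t))
      coordinate-[] (var v)   θ = refl
      coordinate-[] (op f ts) θ = coordinate-[] (ts _) θ

      -- `coordinate` respects identities and substitution, so it maps the clone of `A` to
      -- projections, which then satisfy `𝓢` in every algebra.
      Satisfies⇒Trivial : (𝓢 : EqCondition ℓ) → Satisfies A 𝓢 → Trivial 𝓢
      Satisfies⇒Trivial 𝓢 (τ , τ-sat) S′ B = π , λ e ρ →
          B.trans (project (lhs 𝓢 e) ρ) (B.trans
            (B.reflexive (cong ρ (coordinate-cong (replace τ (lhs 𝓢 e)) (replace τ (rhs 𝓢 e)) (pointwise (τ-sat e)))))
            (B.sym (project (rhs 𝓢 e) ρ)))
        where
        module B = Algebra B
        π : (f : Op (Δ 𝓢)) → TermOf S′ (ar (Δ 𝓢) f)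
        π f = var (coordinate (τ f))
        project : (t : Term (Δ 𝓢) ℕ) (ρ : ℕ → B.Carrier) →
                  B.eval (replace π t) ρ B.≈ ρ (coordinate (replace τ t))
        project (var v)   ρ = B.refl
        project (op f ts) ρ = B.trans (project (ts _) ρ)
          (B.reflexive (cong ρ (sym (coordinate-[] (τ f) _))))

    Taylor⇒Loop : Taylor A → Σ[ n ∈ ℕ ] Loop n
    Taylor⇒Loop (𝓢 , nontrivial , _ , sat) = Inconsistent⇒Loop (decidable-stable em λ con →
      -- The pair (var true , var true) only witnesses that chains have a nonempty index set.
      let Γ , letters⊆Γ , Γ-con , max = maximal Consistent ⟨ Letters ⟩ con (var true , var true) ⋃-consistent
      in nontrivial (Maximal.Satisfies⇒Trivial Γ letters⊆Γ Γ-con max 𝓢 sat))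

  -- Passing between the conditions

  -- On a concrete pattern this computes to the explicit vectors of the conditions, so that
  -- equations between minors can be checked by computation.
  row : ∀ {n} → Carrier → Carrier → (Fin n → Bool) → Vector Carrier n
  row {zero}  x y β = []
  row {suc n} x y β = (if β zero then x else y) ∷ row x y (β ∘ suc)

  row-at : ∀ {n} x y (β : Fin n → Bool) i → row x y β i ≡ (if β i then x else y)
  row-at x y β zero    = refl
  row-at x y β (suc i) = row-at x y (β ∘ suc) i

  eval-≡ : {X : Set} (t : Term S X) {ρ σ : X → Carrier} → (∀ v → ρ v ≡ σ v) → eval t ρ ≈ eval t σ
  eval-≡ t e = eval-cong t (λ v → Algebra.reflexive A (e v))

  eval-minor : ∀ {m n} (t : TermOf S m) (π : Fin m → Fin n) {x y} (β : Fin n → Bool) →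
               eval (t [ (λ i → var (π i)) ]) (row x y β) ≈ eval t (row x y (β ∘ π))
  eval-minor t π β = ≈-trans (eval-[] t _ _)
    (eval-≡ t (λ i → trans (row-at _ _ β (π i)) (sym (row-at _ _ (β ∘ π) i))))

  position : Bool → Bool → Bool → Fin 6
  position true  false false = # 0
  position false true  false = # 1
  position false false true  = # 2
  position false true  true  = # 3
  position true  false true  = # 4
  position true  true  false = # 5
  -- A default for the two constant triples, which `position-correct` excludes.
  position _     _     _     = # 0

  cube-row : Fin 3 → Fin 6 → Bool
  cube-row = (true  ∷ false ∷ false ∷ false ∷ true  ∷ true  ∷ [])
           ∷ (false ∷ true  ∷ false ∷ true  ∷ false ∷ true  ∷ [])
           ∷ (false ∷ false ∷ true  ∷ true  ∷ true  ∷ false ∷ []) ∷ []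

  position-correct : ∀ b₀ b₁ b₂ → ¬ (b₁ ≡ b₀ × b₂ ≡ b₀) → ∀ k →
                     cube-row k (position b₀ b₁ b₂) ≡ (b₀ ∷ b₁ ∷ b₂ ∷ []) k
  position-correct true  true  true  n _ = contradiction (refl , refl) n
  position-correct false false false n _ = contradiction (refl , refl) n
  position-correct true  false false _ = λ { zero → refl ; (suc zero) → refl ; (suc (suc zero)) → refl }
  position-correct false true  false _ = λ { zero → refl ; (suc zero) → refl ; (suc (suc zero)) → refl }
  position-correct false false true  _ = λ { zero → refl ; (suc zero) → refl ; (suc (suc zero)) → refl }
  position-correct false true  true  _ = λ { zero → refl ; (suc zero) → refl ; (suc (suc zero)) → refl }
  position-correct true  false true  _ = λ { zero → refl ; (suc zero) → refl ; (suc (suc zero)) → refl }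
  position-correct true  true  false _ = λ { zero → refl ; (suc zero) → refl ; (suc (suc zero)) → refl }

  R-constant⇒weak-3-cube : ∀ p → R (λ _ → p) → HasWeak3CubeTerm A
  R-constant⇒weak-3-cube p (U , h) = t , λ x y →
      ≈-trans (value-at x y (# 0)) (≈-sym (value-at x y (# 1)))
    , ≈-trans (value-at x y (# 1)) (≈-sym (value-at x y (# 2)))
    where
    index : NotAllEqual → Fin 6
    index ν = position (bit ν (# 0)) (bit ν (# 1)) (bit ν (# 2))
    not-constant : ∀ ν → ¬ (bit ν (# 1) ≡ bit ν (# 0) × bit ν (# 2) ≡ bit ν (# 0))
    not-constant ν (e₁ , e₂) = Bool.not-¬ refl
      (trans (sym (constant (second ν))) (trans (differs ν) (cong not (constant (first ν)))))
      where
      constant : ∀ k → bit ν k ≡ bit ν (# 0)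
      constant zero             = refl
      constant (suc zero)       = e₁
      constant (suc (suc zero)) = e₂
    index-correct : ∀ ν k → cube-row k (index ν) ≡ bit ν k
    index-correct ν k = trans (position-correct _ _ _ (not-constant ν) k) (η k)
      where
      η : ∀ k → (bit ν (# 0) ∷ bit ν (# 1) ∷ bit ν (# 2) ∷ []) k ≡ bit ν k
      η zero             = refl
      η (suc zero)       = refl
      η (suc (suc zero)) = refl
    t : TermOf S 6
    t = U [ (λ ν → var (index ν)) ]
    value-at : ∀ x y i → eval t (row x y (cube-row i)) ≈ eval p (λ b → if b then x else y)
    value-at x y i = ≈-trans (eval-[] U _ _) (≈-trans
      (eval-≡ U (λ ν → trans (row-at x y (cube-row i) (index ν))
        (cong (λ b → if b then x else y) (index-correct ν i))))
      (≈-trans (≈-sym (eval-[] U _ _)) (h i .at _)))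

  -- (z₁ , z₂ , z₃) is not constant iff z₁ ≠ z₂ or z₂ ≠ z₃, so the columns
  -- (z₁ , z₂ , z₂ , z₃) occur in a double loop term.
  weak-3-cube⇒strong-double-loop : HasWeak3CubeTerm A → HasStrongDoubleLoopTerm A
  weak-3-cube⇒strong-double-loop (t , h) = t [ (λ i → var (π i)) ] , λ x y →
    let m = eval-minor t π {x} {y}
        e = proj₁ (h x y)
        e′ = proj₂ (h x y)
        r₁ = m (true  ∷ true  ∷ true  ∷ true  ∷ true  ∷ true  ∷ false ∷ false ∷ false ∷ false ∷ false ∷ false ∷ [])
        r₂ = m (true  ∷ true  ∷ false ∷ false ∷ false ∷ false ∷ true  ∷ true  ∷ true  ∷ true  ∷ false ∷ false ∷ [])
        r₃ = m (true  ∷ false ∷ true  ∷ true  ∷ false ∷ false ∷ true  ∷ true  ∷ false ∷ false ∷ true  ∷ false ∷ [])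
        r₄ = m (false ∷ true  ∷ true  ∷ false ∷ true  ∷ false ∷ true  ∷ false ∷ true  ∷ false ∷ false ∷ true  ∷ [])
    in ≈-trans r₁ (≈-trans e (≈-sym r₂)) , ≈-trans r₂ (≈-sym r₃) , ≈-trans r₃ (≈-trans e′ (≈-sym r₄))
    where
    π : Fin 6 → Fin 12
    π = # 5 ∷ # 7 ∷ # 11 ∷ # 6 ∷ # 4 ∷ # 0 ∷ []

  strong-double-loop⇒double-loop : HasStrongDoubleLoopTerm A → HasDoubleLoopTerm A
  strong-double-loop⇒double-loop (d , h) = d , λ x y → proj₁ (h x y) , proj₂ (proj₂ (h x y))

  xxy xyx yxx : Fin 3 → Bool
  xxy = true  ∷ true  ∷ false ∷ []
  xyx = true  ∷ false ∷ true  ∷ []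
  yxx = false ∷ true  ∷ true  ∷ []

  xxyy xyxy yxxy : Fin 4 → Bool
  xxyy = true  ∷ true  ∷ false ∷ false ∷ []
  xyxy = true  ∷ false ∷ true  ∷ false ∷ []
  yxxy = false ∷ true  ∷ true  ∷ false ∷ []

  -- The columns of q₁ are (u , z₁ , z₂) and those of q₂ are (v , z₂ , z₃), where u = x
  -- iff z₁ ≠ z₂, and v = x iff z₂ ≠ z₃; those of c are (w , u , v) with one y.
  weak-3-cube⇒q₁q₂c : HasWeak3CubeTerm A → HasTermsQ₁Q₂C A
  weak-3-cube⇒q₁q₂c (t , h) =
    t [ (λ i → var (π₁ i)) ] , t [ (λ i → var (π₂ i)) ] , t [ (λ i → var (π₀ i)) ] , λ x y →
    let m₁ = eval-minor t π₁ {x} {y}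
        m₂ = eval-minor t π₂ {x} {y}
        m₀ = eval-minor t π₀ {x} {y}
        e = proj₁ (h x y)
        e′ = proj₂ (h x y)
    in ≈-trans (m₁ xyxy) (≈-trans e (≈-sym (m₁ yxxy)))
     , ≈-trans (m₁ yxxy) (≈-sym (m₂ xyxy))
     , ≈-trans (m₂ xyxy) (≈-trans e′ (≈-sym (m₂ yxxy)))
     , ≈-trans (m₁ xxyy) (≈-sym (m₀ xyx))
     , ≈-trans (m₂ xxyy) (≈-sym (m₀ yxx))
    where
    π₁ π₂ : Fin 6 → Fin 4
    π₁ = # 0 ∷ # 1 ∷ # 3 ∷ # 1 ∷ # 0 ∷ # 2 ∷ []
    π₂ = # 3 ∷ # 0 ∷ # 1 ∷ # 2 ∷ # 1 ∷ # 0 ∷ []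
    π₀ : Fin 6 → Fin 3
    π₀ = # 0 ∷ # 2 ∷ # 1 ∷ # 0 ∷ # 2 ∷ # 1 ∷ []

  -- The minors are chosen so that, for each i, the branches of cᵢ and one half of the agreement
  -- hold identically; the other half is qᵢ(x,y,x,y) ≈ qᵢ(y,x,x,y). Swapping the first two variables
  -- between `π₁₁`, `π₁₂` and `π₂₁`, `π₂₂` makes the strong equation compare the common values of
  -- `q₁` and `q₂`.
  q₁q₂c⇒strong-terminator : HasTermsQ₁Q₂C A → StrongTerminatorTerms A
  q₁q₂c⇒strong-terminator (q₁ , q₂ , c , h) = record
    { c = c
    ; c₁ = minor q₁ π ; c₁₁ = minor q₁ π₁₁ ; c₁₂ = minor q₁ π₁₂
    ; c₂ = minor q₂ π ; c₂₁ = minor q₂ π₂₁ ; c₂₂ = minor q₂ π₂₂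
    ; c-branches = λ x y → let (_ , _ , _ , e , e′) = h x y in
        ≈-sym (≈-trans (eval-minor q₁ π xxy) e) , ≈-sym (≈-trans (eval-minor q₂ π xxy) e′)
    ; c₁-branches = λ x y →
        ≈-trans (eval-minor q₁ π xyx) (≈-sym (eval-minor q₁ π₁₁ xxy))
      , ≈-trans (eval-minor q₁ π yxx) (≈-sym (eval-minor q₁ π₁₂ xxy))
    ; c₂-branches = λ x y →
        ≈-trans (eval-minor q₂ π xyx) (≈-sym (eval-minor q₂ π₂₁ xxy))
      , ≈-trans (eval-minor q₂ π yxx) (≈-sym (eval-minor q₂ π₂₂ xxy))
    ; c₁-agree = λ x y → let (e , _) = h x y in
        ≈-trans (eval-minor q₁ π₁₁ xyx) (≈-sym (eval-minor q₁ π₁₂ xyx))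
      , ≈-trans (eval-minor q₁ π₁₁ yxx) (≈-trans e (≈-sym (eval-minor q₁ π₁₂ yxx)))
    ; c₂-agree = λ x y → let (_ , _ , e , _) = h x y in
        ≈-trans (eval-minor q₂ π₂₁ xyx) (≈-trans e (≈-sym (eval-minor q₂ π₂₂ xyx)))
      , ≈-trans (eval-minor q₂ π₂₁ yxx) (≈-sym (eval-minor q₂ π₂₂ yxx))
    } , λ x y → let (e₁ , e₂ , e₃ , _) = h x y in
        ≈-trans (eval-minor q₁ π₁₁ yxx) (≈-trans e₁ (≈-trans e₂ (≈-trans e₃ (≈-sym (eval-minor q₂ π₂₂ xyx)))))
    where
    minor : TermOf S 4 → (Fin 4 → Fin 3) → TermOf S 3
    minor q ϖ = q [ (λ i → var (ϖ i)) ]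
    π π₁₁ π₁₂ π₂₁ π₂₂ : Fin 4 → Fin 3
    π   = # 1 ∷ # 0 ∷ # 2 ∷ # 2 ∷ []
    π₁₁ = # 2 ∷ # 0 ∷ # 1 ∷ # 0 ∷ []
    π₁₂ = # 0 ∷ # 2 ∷ # 1 ∷ # 0 ∷ []
    π₂₁ = # 2 ∷ # 1 ∷ # 0 ∷ # 1 ∷ []
    π₂₂ = # 1 ∷ # 2 ∷ # 0 ∷ # 1 ∷ []

  -- Conditions whose equations identify binary minors; variable 0 is x, variable 1 is y.
  module Minors {Sym : Set} (arity : Sym → ℕ) where
    Minor : Set
    Minor = Σ[ f ∈ Sym ] (Fin (arity f) → Bool)

    minor-term : Minor → Term record { Op = Level.Lift ℓ Sym ; ar = arity ∘ Level.lower } ℕ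
    minor-term (f , β) = op (Level.lift f) (λ i → var (if β i then 0 else 1))

    condition : ∀ {n} → (Fin n → Minor × Minor) → EqCondition ℓ
    condition {n} eqs = record
      { Δ = record { Op = Level.Lift ℓ Sym ; ar = arity ∘ Level.lower }
      ; Eqn = Level.Lift ℓ (Fin n ⊎ Sym)
      ; lhs = λ { (Level.lift (inj₁ i)) → minor-term (proj₁ (eqs i))
                ; (Level.lift (inj₂ f)) → op (Level.lift f) (λ _ → var 0) }
      ; rhs = λ { (Level.lift (inj₁ i)) → minor-term (proj₂ (eqs i))
                ; (Level.lift (inj₂ f)) → var 0 }
      }

    module _ {n : ℕ} (eqs : Fin n → Minor × Minor) where
      ProjectionsSatisfy : ((f : Sym) → Fin (arity f)) → Set
      ProjectionsSatisfy π = ∀ i → let (f , β) , (g , γ) = eqs i in β (π f) ≡ γ (π g)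

      no-operations : Signature ℓ
      no-operations = record { Op = Level.Lift ℓ ⊥ ; ar = λ () }

      two : Algebra no-operations
      two = record
        { domain = ≡.setoid (Level.Lift ℓ Bool) ; interp = λ () ; interp-cong = λ () }

      variable-of : {X : Set} (t : Term no-operations X) → Σ[ v ∈ X ] t ≡ var v
      variable-of (var v) = v , refl

      -- Without operations every term is a variable, and x = true, y = false tells the two values
      -- apart.
      Trivial⇒projections : Trivial (condition eqs) → Σ[ π ∈ ((f : Sym) → Fin (arity f)) ] ProjectionsSatisfy π
      Trivial⇒projections triv with triv no-operations two
      ... | τ , sat = π , λ i → cong Level.lower
          (trans (sym (value-of (proj₁ (eqs i)))) (trans (sat (Level.lift (inj₁ i)) ρ) (value-of (proj₂ (eqs i)))))
        where
        ρ : ℕ → Level.Lift ℓ Bool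
        ρ zero    = Level.lift true
        ρ (suc _) = Level.lift false
        ρ-if : ∀ b → ρ (if b then 0 else 1) ≡ Level.lift b
        ρ-if true  = refl
        ρ-if false = refl
        π : (f : Sym) → Fin (arity f)
        π f = proj₁ (variable-of (τ (Level.lift f)))
        value-of : ∀ m → Algebra.eval two (replace τ (minor-term m)) ρ ≡ Level.lift (proj₂ m (π (proj₁ m)))
        value-of (f , β) with τ (Level.lift f)
        ... | var i = ρ-if (β i)

      minors⇒Taylor : (τ : (f : Sym) → TermOf S (arity f)) →
        (∀ i x y → let (f , β) , (g , γ) = eqs i in eval (τ f) (row x y β) ≈ eval (τ g) (row x y γ)) →
        (∀ π → ¬ ProjectionsSatisfy π) → Taylor A
      minors⇒Taylor τ hyp none = condition eqs
        , (λ triv → let π , sat = Trivial⇒projections triv in none π sat)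
        , (λ f B sat → sat (Level.lift (inj₂ (Level.lower f))))
        , τ ∘ Level.lower
        , λ { (Level.lift (inj₁ i)) ρ → ≈-trans (minor-value (proj₁ (eqs i)) ρ)
                (≈-trans (hyp i (ρ 0) (ρ 1)) (≈-sym (minor-value (proj₂ (eqs i)) ρ)))
            ; (Level.lift (inj₂ f)) ρ → ≈-trans (eval-[] (τ f) _ ρ) (eval-const (τ f) (ρ 0)) }
        where
        eval-if : ∀ b (ρ : ℕ → Carrier) → ρ (if b then 0 else 1) ≡ (if b then ρ 0 else ρ 1)
        eval-if true  ρ = refl
        eval-if false ρ = refl
        minor-value : ∀ m ρ → eval (replace (τ ∘ Level.lower) (minor-term m)) ρ ≈ eval (τ (proj₁ m)) (row (ρ 0) (ρ 1) (proj₂ m))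
        minor-value (f , β) ρ = ≈-trans (eval-[] (τ f) _ ρ)
          (eval-≡ (τ f) (λ i → trans (eval-if (β i) ρ) (sym (row-at _ _ β i))))

  -- The columns are the (z₁ , z₂ , z₃ , z₄) with z₁ ≠ z₂ or z₃ ≠ z₄, so each projection violates
  -- one of the equations.
  double-loop⇒Taylor : HasDoubleLoopTerm A → Taylor A
  double-loop⇒Taylor (d , h) = minors⇒Taylor
    (((tt , r₁) , (tt , r₂)) ∷ ((tt , r₃) , (tt , r₄)) ∷ [])
    (λ _ → d)
    (λ { zero x y → proj₁ (h x y) ; (suc zero) x y → proj₂ (h x y) })
    (λ π sat → no-column (π tt) (sat zero , sat (suc zero)))
    where
    open Minors {⊤} (λ _ → 12)
    r₁ r₂ r₃ r₄ : Fin 12 → Bool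
    r₁ = true  ∷ true  ∷ true  ∷ true  ∷ true  ∷ true  ∷ false ∷ false ∷ false ∷ false ∷ false ∷ false ∷ []
    r₂ = true  ∷ true  ∷ false ∷ false ∷ false ∷ false ∷ true  ∷ true  ∷ true  ∷ true  ∷ false ∷ false ∷ []
    r₃ = true  ∷ false ∷ true  ∷ true  ∷ false ∷ false ∷ true  ∷ true  ∷ false ∷ false ∷ true  ∷ false ∷ []
    r₄ = false ∷ true  ∷ true  ∷ false ∷ true  ∷ false ∷ true  ∷ false ∷ true  ∷ false ∷ false ∷ true  ∷ []
    no-column : ∀ i → ¬ (r₁ i ≡ r₂ i × r₃ i ≡ r₄ i)
    no-column = from-yes (all? λ i → ¬? ((r₁ i Bool.≟ r₂ i) ×-dec (r₃ i Bool.≟ r₄ i)))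

  data TerminatorSymbol : Set where
    ∙ ∙₁ ∙₂ ∙₁₁ ∙₁₂ ∙₂₁ ∙₂₂ : TerminatorSymbol

  -- For projections, the lower equations force `c₁` and `c₂` to be the third one. Then `c` would
  -- have to take the value y at both (x,y,x) and (y,x,x).
  terminator⇒Taylor : TerminatorTerms A → Taylor A
  terminator⇒Taylor T = minors⇒Taylor
    ( ((∙ , xyx) , (∙₁ , xxy)) ∷ ((∙ , yxx) , (∙₂ , xxy))
    ∷ ((∙₁ , xyx) , (∙₁₁ , xxy)) ∷ ((∙₁ , yxx) , (∙₁₂ , xxy))
    ∷ ((∙₂ , xyx) , (∙₂₁ , xxy)) ∷ ((∙₂ , yxx) , (∙₂₂ , xxy))
    ∷ ((∙₁₁ , xyx) , (∙₁₂ , xyx)) ∷ ((∙₁₁ , yxx) , (∙₁₂ , yxx))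
    ∷ ((∙₂₁ , xyx) , (∙₂₂ , xyx)) ∷ ((∙₂₁ , yxx) , (∙₂₂ , yxx)) ∷ [])
    (λ { ∙ → c ; ∙₁ → c₁ ; ∙₂ → c₂ ; ∙₁₁ → c₁₁ ; ∙₁₂ → c₁₂ ; ∙₂₁ → c₂₁ ; ∙₂₂ → c₂₂ })
    (∀-cons (λ x y → proj₁ (c-branches x y)) (∀-cons (λ x y → proj₂ (c-branches x y))
    (∀-cons (λ x y → proj₁ (c₁-branches x y)) (∀-cons (λ x y → proj₂ (c₁-branches x y))
    (∀-cons (λ x y → proj₁ (c₂-branches x y)) (∀-cons (λ x y → proj₂ (c₂-branches x y))
    (∀-cons (λ x y → proj₁ (c₁-agree x y)) (∀-cons (λ x y → proj₂ (c₁-agree x y))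
    (∀-cons (λ x y → proj₁ (c₂-agree x y)) (∀-cons (λ x y → proj₂ (c₂-agree x y)) λ ()))))))))))
    (λ π sat → top (π ∙) (π ∙₁) (π ∙₂)
      (third (π ∙₁) (π ∙₁₁) (π ∙₁₂) ((sat (# 2) , sat (# 3)) , (sat (# 6) , sat (# 7))))
      (third (π ∙₂) (π ∙₂₁) (π ∙₂₂) ((sat (# 4) , sat (# 5)) , (sat (# 8) , sat (# 9))))
      (sat (# 0) , sat (# 1)))
    where
    open TerminatorTerms T
    open Minors {TerminatorSymbol} (λ _ → 3)
    branches? : ∀ p p₁ p₂ → Dec (xyx p ≡ xxy p₁ × yxx p ≡ xxy p₂)
    branches? p p₁ p₂ = (xyx p Bool.≟ xxy p₁) ×-dec (yxx p Bool.≟ xxy p₂)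
    agree? : ∀ p₁ p₂ → Dec (xyx p₁ ≡ xyx p₂ × yxx p₁ ≡ yxx p₂)
    agree? p₁ p₂ = (xyx p₁ Bool.≟ xyx p₂) ×-dec (yxx p₁ Bool.≟ yxx p₂)
    third : ∀ p p₁ p₂ → ((xyx p ≡ xxy p₁ × yxx p ≡ xxy p₂) × (xyx p₁ ≡ xyx p₂ × yxx p₁ ≡ yxx p₂)) → p ≡ # 2
    third = from-yes (all? λ p → all? λ p₁ → all? λ p₂ → (branches? p p₁ p₂ ×-dec agree? p₁ p₂) →-dec (p ≟ # 2))
    top : ∀ p p₁ p₂ → p₁ ≡ # 2 → p₂ ≡ # 2 → ¬ (xyx p ≡ xxy p₁ × yxx p ≡ xxy p₂)
    top = from-yes (all? λ p → all? λ p₁ → all? λ p₂ → (p₁ ≟ # 2) →-dec ((p₂ ≟ # 2) →-dec ¬? (branches? p p₁ p₂)))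

theorem6p1 : (∀ {a} → ExcludedMiddle a) →
    (∀ {a b} → Extensionality a b) →
    ∀ {ℓ : Level} (S : Signature ℓ) (A : Algebra S) → Idempotent A →
    (Taylor A ⇔ HasDoubleLoopTerm A)
    × (Taylor A ⇔ HasStrongDoubleLoopTerm A)
    × (Taylor A ⇔ HasWeak3CubeTerm A)
    × (Taylor A ⇔ HasTermsQ₁Q₂C A)
    × (Taylor A ⇔ TerminatorTerms A)
    × (Taylor A ⇔ StrongTerminatorTerms A)
theorem6p1 em ext S A idem =
    mk⇔ (strong-double-loop⇒double-loop ∘ strong-double-loop) double-loop⇒Taylor
  , mk⇔ strong-double-loop (double-loop⇒Taylor ∘ strong-double-loop⇒double-loop)
  , mk⇔ weak-3-cube
        (double-loop⇒Taylor ∘ strong-double-loop⇒double-loop ∘ weak-3-cube⇒strong-double-loop)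
  , mk⇔ q₁q₂c (terminator⇒Taylor ∘ proj₁ ∘ q₁q₂c⇒strong-terminator)
  , mk⇔ (proj₁ ∘ q₁q₂c⇒strong-terminator ∘ q₁q₂c) terminator⇒Taylor
  , mk⇔ (q₁q₂c⇒strong-terminator ∘ q₁q₂c) (terminator⇒Taylor ∘ proj₁)
  where
  open Idem A idem
  open Classical em ext
  weak-3-cube : Taylor A → HasWeak3CubeTerm A
  weak-3-cube taylor =
    let n , L = Taylor⇒Loop taylor
        -- Since `n` may be 0 or 1, two literals are added before the reduction to two.
        L₂ = Loop-2 n (subst Loop (+-comm n 2) (Loop-weaken 2 L))
    in R-constant⇒weak-3-cube (⟦_⟧ L₂ root) (R-resp (∀-cons ≐-refl (∀-cons ≐-refl (∀-cons ≐-refl λ ()))) (R-root L₂))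
  strong-double-loop : Taylor A → HasStrongDoubleLoopTerm A
  strong-double-loop = weak-3-cube⇒strong-double-loop ∘ weak-3-cube
  q₁q₂c : Taylor A → HasTermsQ₁Q₂C A
  q₁q₂c = weak-3-cube⇒q₁q₂c ∘ weak-3-cube
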